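{- Let $s\ge 1$ and $d\ge 1$ be integers. There exists a non-adaptive one-sided error tester for the property "$s$-binary rank at most $d$" of $n\times m$ $(0,1)$-matrices that makes $O(T\log T)=\tilde O\!\left(\binom{d}{\le s}2^d/\epsilon^2\right)$ queries, where $T=324\,d^2\binom{d}{\le s}2^d/\epsilon^2$. The same query bound is achievable by a non-adaptive one-sided error tester for the property "$s$-binary rank exactly $d$".
   Context: For a $(0,1)$-matrix $M$ of size $n\times m$, $M[i,j]$ denotes its $(i,j)$ entry and $[n]=\{1,\dots,n\}$. The $s$-binary rank ${\rm br}_s(M)$ is the minimal integer $d\ge 0$ such that there exist $d$ sets (rectangles) $I_k\times J_k$ with $I_k\subseteq[n]$, $J_k\subseteq[m]$, $k\in[d]$, with $M[i,j]=1$ for all $(i,j)\in I_k\times J_k$ and all $k$, and such that every $(i,j)$ with $M[i,j]=1$ lies in at least one and at most $s$ of the rectangles. $\binom{d}{\le s}=\sum_{i=0}^{s}\binom{d}{i}$. A matrix $M$ is $\epsilon$-far from a property if more than an $\epsilon$-fraction of its $nm$ entries must be modified to obtain a matrix with the property. A tester receives $0<\epsilon<1$, $d,s,n,m$ and query access to the entries of $M$; if $M$ has the property it accepts with probability at least $2/3$, and if $M$ is $\epsilon$-far from the property it rejects with probability at least $2/3$. It is one-sided if it accepts matrices with the property with probability $1$. It is non-adaptive if all its queries are fixed in advance (possibly using randomness) before any answer is seen. $\tilde O$ hides factors polylogarithmic in $\binom{d}{\le s}2^d$ and $1/\epsilon$.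
   Formalization: The distance parameter ε is taken to be rational with 0 < ε < 1; a real ε can be replaced by a rational in [ε/2, ε], which changes T by a factor of at most 4. -}

module Defs where

open import Data.Bool using (Bool; true; false; _∧_; _xor_)
open import Data.Fin using (Fin; toℕ)
open import Data.Fin.Subset using (Subset; _∈_; ∣_∣; ∁)
import Data.Integer as ℤ
open import Data.List using (List; map; length)
open import Data.Nat as ℕ using (ℕ; suc; NonZero)
open import Data.Nat.Combinatorics using (_C_)
open import Data.Nat.Logarithm using (⌈log₂_⌉)
open import Data.Product using (∃-syntax; Σ-syntax; _×_; _,_)
open import Data.Rational as ℚ using (ℚ; 1ℚ; _/_; 1/_; Positive)
open import Data.Rational.Properties using (pos⇒nonZero)
open import Data.Vec as Vec using (lookup; tabulate)
open import Relation.Binary.PropositionalEquality using (_≡_)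

Matrix : ℕ → ℕ → Set
Matrix n m = Fin n → Fin m → Bool

Property : ℕ → ℕ → Set₁
Property n m = Matrix n m → Set

-- The set of those indices k for which (i , j) ∈ I k × J k.
rectanglesAt : ∀ {n m r} → (Fin r → Subset n) → (Fin r → Subset m) →
               Fin n → Fin m → Subset r
rectanglesAt I J i j = tabulate λ k → lookup (I k) i ∧ lookup (J k) j

record IsCover (s : ℕ) {n m r : ℕ} (M : Matrix n m)
               (I : Fin r → Subset n) (J : Fin r → Subset m) : Set where
  field
    monochromatic : ∀ k i j → i ∈ I k → j ∈ J k → M i j ≡ true
    covered       : ∀ i j → M i j ≡ true → 1 ℕ.≤ ∣ rectanglesAt I J i j ∣
    multiplicity  : ∀ i j → M i j ≡ true → ∣ rectanglesAt I J i j ∣ ℕ.≤ s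

HasCover : ℕ → ∀ {n m} → Matrix n m → ℕ → Set
HasCover s {n} {m} M r =
  Σ[ I ∈ (Fin r → Subset n) ] Σ[ J ∈ (Fin r → Subset m) ] IsCover s M I J

-- IsBinaryRank s M r says that br_s(M) = r.
IsBinaryRank : ℕ → ∀ {n m} → Matrix n m → ℕ → Set
IsBinaryRank s M r = HasCover s M r × (∀ r′ → HasCover s M r′ → r ℕ.≤ r′)

BinaryRankAtMost : ℕ → ℕ → ∀ {n m} → Property n m
BinaryRankAtMost s d M = ∃[ r ] IsBinaryRank s M r × r ℕ.≤ d

BinaryRankExactly : ℕ → ℕ → ∀ {n m} → Property n m
BinaryRankExactly s d M = IsBinaryRank s M d

fromℕ : ℕ → ℚ
fromℕ k = ℤ.+ k / 1

-- The number of entries in which two matrices differ.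
distance : ∀ {n m} → Matrix n m → Matrix n m → ℕ
distance M M′ = Vec.sum (tabulate λ i → ∣ tabulate (λ j → M i j xor M′ i j) ∣)

Far : ℚ → ∀ {n m} → Property n m → Matrix n m → Set
Far ε {n} {m} P M =
  ∀ M′ → P M′ → ε ℚ.* fromℕ (n ℕ.* m) ℚ.< fromℕ (distance M M′)

-- A seed is drawn uniformly from Fin seeds.  Non-adaptivity: the queries are a
-- function of the seed alone, and only the verdict depends on the answers.
record NonAdaptiveTester (n m : ℕ) : Set where
  field
    seeds            : ℕ
    {{seeds-nonZero}} : NonZero seeds
    queries          : Fin seeds → List (Fin n × Fin m)
    verdict          : Fin seeds → List Bool → Bool

  probability : Subset seeds → ℚ
  probability E = ℤ.+ ∣ E ∣ / seeds

  accepting : Matrix n m → Subset seeds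
  accepting M = tabulate λ ρ → verdict ρ (map (λ (i , j) → M i j) (queries ρ))

  acceptProbability : Matrix n m → ℚ
  acceptProbability M = probability (accepting M)

  rejectProbability : Matrix n m → ℚ
  rejectProbability M = probability (∁ (accepting M))

open NonAdaptiveTester public

record IsTester {n m : ℕ} (ε : ℚ) (P : Property n m)
                (τ : NonAdaptiveTester n m) : Set where
  field
    complete : ∀ M → P M → ℤ.+ 2 / 3 ℚ.≤ acceptProbability τ M
    sound    : ∀ M → Far ε P M → ℤ.+ 2 / 3 ℚ.≤ rejectProbability τ M

OneSided : ∀ {n m} → Property n m → NonAdaptiveTester n m → Set
OneSided P τ = ∀ M → P M → acceptProbability τ M ≡ 1ℚ

-- Worst case over the seeds.
MakesAtMost : ∀ {n m} → NonAdaptiveTester n m → ℚ → Set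
MakesAtMost τ q = ∀ ρ → fromℕ (length (queries τ ρ)) ℚ.≤ q

-- Binomial sum: d C 0 + … + d C s.
_C≤_ : ℕ → ℕ → ℕ
d C≤ s = Vec.sum (tabulate {n = suc s} λ i → d C toℕ i)

inverse : (ε : ℚ) .{{_ : Positive ε}} → ℚ
inverse ε = (1/ ε) {{pos⇒nonZero ε}}

-- Logarithm with the argument and the result rounded up.  For x ≥ 2 it is
-- within a constant factor of log₂ x, and for 1 < x it is at least 1, so
-- that polylogarithmic factors in 1/ε do not degenerate as ε tends to 1.
log : ℚ → ℕ
log x = ⌈log₂ ℤ.∣ ℚ.ceiling x ∣ ⌉

T : (s d : ℕ) (ε : ℚ) .{{_ : Positive ε}} → ℚ
T s d ε = fromℕ (324 ℕ.* d ℕ.^ 2 ℕ.* (d C≤ s) ℕ.* 2 ℕ.^ d)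
          ℚ.* (inverse ε ℚ.* inverse ε)

TlogT : (s d : ℕ) (ε : ℚ) .{{_ : Positive ε}} → ℚ
TlogT s d ε = T s d ε ℚ.* fromℕ (log (T s d ε))

-- A property of n × m matrices, for all n and m, with parameters s and d, has
-- non-adaptive one-sided testers making O(T log T) queries; the constant is
-- absolute, i.e. independent of s, d, ε, n and m.
TestableWithTlogTQueries : (ℕ → ℕ → ∀ {n m} → Property n m) → Set
TestableWithTlogTQueries P =
  ∃[ c ] ∀ s d → 1 ℕ.≤ s → 1 ℕ.≤ d →
    Σ[ τ ∈ ((ε : ℚ) .{{_ : Positive ε}} (n m : ℕ) → NonAdaptiveTester n m) ]
      (∀ (ε : ℚ) .{{_ : Positive ε}} → ε ℚ.< 1ℚ → ∀ n m →
         IsTester ε (P s d) (τ ε n m)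
         × OneSided (P s d) (τ ε n m)
         × MakesAtMost (τ ε n m) (fromℕ c ℚ.* TlogT s d ε))

-- N/ε² times the k-th power of the logarithms of N and of 1/ε, for
-- N = (d C≤ s) 2ᵈ.
polylogBound : ℕ → (s d : ℕ) (ε : ℚ) .{{_ : Positive ε}} → ℚ
polylogBound k s d ε =
  fromℕ N ℚ.* (inverse ε ℚ.* inverse ε)
  ℚ.* fromℕ ((log (fromℕ N) ℕ.* log (inverse ε)) ℕ.^ k)
  where
  N : ℕ
  N = (d C≤ s) ℕ.* 2 ℕ.^ d

{-# OPTIONS --safe #-}

-- A sample is accepted when some matrix with the property agrees with M on the queries, which
-- never rejects wrongly.  For soundness, let a sample X × Y of M have a d-cover, at most t distinct
-- rows and at most u distinct columns.  Predict M r c by the entry of a sampled row and a sampled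
-- column that look like r and c.  The prediction has a d-cover too, so it errs often if M is far
-- from all such matrices.  By exchangeability, the predicted row and column may be any members of a
-- sample with one more row and column, and an error forces one of them to differ from all the
-- others, which happens for at most t + 1 rows and u + 1 columns.  Hence such samples are rare
-- once X and Y are long compared with t and u.
--
-- In a matrix with a d-cover of multiplicity s, rows * cols ≤ (d C≤ s) 2ᵈ: the sets of rectangles
-- contained in that of some row, and likewise of some column, form two down-sets of subsets of [d]
-- whose common members have size at most s, and Kleitman's inequality applies.  Test prefixes of X
-- and Y of growing respectively shrinking length.  The number of distinct rows starts at 1 or more
-- and ends below 2^(d + 1), so at some step i it passes from at least 2^i to less than 2^(i + 1),
-- and then the number of columns is at most (d C≤ s) 2^(d - i), as the rarity bound requires.
--
-- A matrix with a d-cover is within distance d² of one of rank exactly d, unless none exists.  So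
-- the same sampling tests both properties if n m is large compared with d²/ε; otherwise all
-- entries are queried.

module Submission where

open import Defs
open import Data.Bool using (Bool; true; false; _∧_; _xor_; if_then_else_)
import Data.Bool.Properties as Bool
open import Data.Empty using (⊥-elim)
open import Data.Fin as Fin using (Fin; zero; suc; toℕ; fromℕ<; inject≤; punchOut)
import Data.Fin.Properties as Fin
open import Data.Fin.Subset as Sub using (Subset; ∣_∣; ∁; _⊆_)
open import Data.Fin.Subset.Properties using (_⊆?_; ⊆-trans; s⊆s; out⊆; p⊆q⇒∣p∣≤∣q∣; ∣∁p∣≡n∸∣p∣)
open import Data.List as List using (List; []; _∷_; length; filter; cartesianProductWith; cartesianProduct; allFin; concatMap)
import Data.List.Properties as List
open import Data.List.Membership.Propositional using (_∈_; lose)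
open import Data.List.Membership.Propositional.Properties
open import Data.List.Membership.Setoid.Properties using (index-injective)
open import Data.List.Relation.Unary.All as All using ([]; _∷_)
import Data.List.Relation.Unary.All.Properties as All
open import Data.List.Relation.Unary.AllPairs using ([]; _∷_)
open import Data.List.Relation.Unary.Any as Any using (here; there)
open import Data.List.Relation.Unary.Unique.Propositional using (Unique)
import Data.List.Relation.Unary.Unique.Propositional.Properties as Unique
open import Data.Maybe using (Maybe; just; nothing; maybe′)
open import Data.Nat
open import Data.Nat.Combinatorics using (_C_; nCk+nC[k+1]≡[n+1]C[k+1])
open import Data.Nat.Logarithm
open import Data.Nat.Properties
open import Data.Nat.Tactic.RingSolver using (solve-∀)
open import Data.Product
open import Data.Sum using (_⊎_; inj₁; inj₂; [_,_]′)
open import Data.Unit using (tt)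
open import Data.Vec as Vec using (Vec; []; _∷_; lookup; tabulate; removeAt; truncate)
open import Data.Vec.Membership.Propositional.Properties using (∈-toList⁺) renaming (∈-lookup to ∈ᵛ-lookup)
import Data.Vec.Properties as Vec
import Data.Integer as ℤ
import Data.Integer.DivMod as ℤ
import Data.Integer.Properties as ℤ
open import Data.Nat.DivMod using (m≡m%n+[m/n]*n; m%n<n)
open import Data.Nat.Induction using (<-rec)
open import Data.Rational as ℚ using (ℚ; mkℚ; 0ℚ; 1ℚ; Positive)
import Data.Rational.Properties as ℚ
import Data.Rational.Solver as ℚ
open import Data.Rational.Unnormalised as ℚᵘ using (ℚᵘ; mkℚᵘ)
import Data.Rational.Unnormalised.Properties as ℚᵘ
open import Function using (_∘_; id; case_of_; flip; Injective)
open import Relation.Binary.PropositionalEquality hiding (J)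
open import Relation.Binary using (tri<; tri≈; tri>)
open import Relation.Nullary
open import Relation.Nullary.Decidable using (dec-true; dec-false; map′)

-- Finite sums over lists

∑ : ∀ {A : Set} → List A → (A → ℕ) → ℕ
∑ []       f = 0
∑ (x ∷ xs) f = f x + ∑ xs f

module _ {A : Set} where

  ∑-mono : ∀ (xs : List A) {f g : A → ℕ} → (∀ x → f x ≤ g x) → ∑ xs f ≤ ∑ xs g
  ∑-mono []       f≤g = z≤n
  ∑-mono (x ∷ xs) f≤g = +-mono-≤ (f≤g x) (∑-mono xs f≤g)

  ∑-cong : ∀ (xs : List A) {f g : A → ℕ} → (∀ x → f x ≡ g x) → ∑ xs f ≡ ∑ xs g
  ∑-cong []       f≡g = refl
  ∑-cong (x ∷ xs) f≡g = cong₂ _+_ (f≡g x) (∑-cong xs f≡g)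

  ∑-+ : ∀ (xs : List A) (f g : A → ℕ) → ∑ xs (λ x → f x + g x) ≡ ∑ xs f + ∑ xs g
  ∑-+ []       f g = refl
  ∑-+ (x ∷ xs) f g =
    trans (cong (f x + g x +_) (∑-+ xs f g)) (interchange (f x) (g x) (∑ xs f) (∑ xs g))
    where
    interchange : ∀ a b c d → a + b + (c + d) ≡ a + c + (b + d)
    interchange = solve-∀

  ∑-* : ∀ c (xs : List A) (f : A → ℕ) → ∑ xs (λ x → c * f x) ≡ c * ∑ xs f
  ∑-* c []       f = sym (*-zeroʳ c)
  ∑-* c (x ∷ xs) f = trans (cong (c * f x +_) (∑-* c xs f)) (sym (*-distribˡ-+ c (f x) _))

  ∑-const : ∀ (xs : List A) c → ∑ xs (λ _ → c) ≡ length xs * c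
  ∑-const []       c = refl
  ∑-const (x ∷ xs) c = cong (c +_) (∑-const xs c)

  ∑-zero : ∀ (xs : List A) → ∑ xs (λ _ → 0) ≡ 0
  ∑-zero xs = trans (∑-const xs 0) (*-zeroʳ (length xs))

  ∑-++ : ∀ (xs ys : List A) (f : A → ℕ) → ∑ (xs List.++ ys) f ≡ ∑ xs f + ∑ ys f
  ∑-++ []       ys f = refl
  ∑-++ (x ∷ xs) ys f = trans (cong (f x +_) (∑-++ xs ys f)) (sym (+-assoc (f x) _ _))

∑-swap : ∀ {A B : Set} (xs : List A) (ys : List B) (f : A → B → ℕ) →
         ∑ xs (λ x → ∑ ys (f x)) ≡ ∑ ys (λ y → ∑ xs (λ x → f x y))
∑-swap []       ys f = sym (∑-zero ys)
∑-swap (x ∷ xs) ys f =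
  trans (cong (∑ ys (f x) +_) (∑-swap xs ys f)) (sym (∑-+ ys (f x) _))

∑-map : ∀ {A B : Set} (g : A → B) xs (f : B → ℕ) → ∑ (List.map g xs) f ≡ ∑ xs (f ∘ g)
∑-map g []       f = refl
∑-map g (x ∷ xs) f = cong (f (g x) +_) (∑-map g xs f)

∑-product : ∀ {A B C : Set} (g : A → B → C) xs ys (f : C → ℕ) →
            ∑ (cartesianProductWith g xs ys) f ≡ ∑ xs λ x → ∑ ys λ y → f (g x y)
∑-product g []       ys f = refl
∑-product g (x ∷ xs) ys f =
  trans (∑-++ (List.map (g x) ys) _ f) (cong₂ _+_ (∑-map (g x) ys f) (∑-product g xs ys f))

length≡∑ : ∀ {A : Set} (xs : List A) → length xs ≡ ∑ xs (λ _ → 1)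
length≡∑ xs = trans (sym (*-identityʳ _)) (sym (∑-const xs 1))

length-product : ∀ {A B C : Set} (g : A → B → C) xs ys →
                 length (cartesianProductWith g xs ys) ≡ length xs * length ys
length-product g xs ys = begin
  length (cartesianProductWith g xs ys)           ≡⟨ length≡∑ (cartesianProductWith g xs ys) ⟩
  ∑ (cartesianProductWith g xs ys) (λ _ → 1)      ≡⟨ ∑-product g xs ys _ ⟩
  ∑ xs (λ _ → ∑ ys (λ _ → 1))                     ≡⟨ ∑-const xs _ ⟩
  length xs * ∑ ys (λ _ → 1)                      ≡⟨ cong (length xs *_) (length≡∑ ys) ⟨
  length xs * length ys                           ∎
  where open ≡-Reasoning

bit : Bool → ℕ
bit true  = 1
bit false = 0

bit≤1 : ∀ b → bit b ≤ 1
bit≤1 true  = ≤-refl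
bit≤1 false = z≤n

-- Iverson bracket
#[_] : ∀ {P : Set} → Dec P → ℕ
#[ P? ] = bit (does P?)

#≤ : ∀ {P : Set} (P? : Dec P) {q} → (P → 1 ≤ q) → #[ P? ] ≤ q
#≤ (yes p) h = h p
#≤ (no _)  h = z≤n

#*≤ : ∀ {P : Set} (P? : Dec P) {x q} → (P → x ≤ q) → #[ P? ] * x ≤ q
#*≤ (yes p) {x} h = ≤-trans (≤-reflexive (+-identityʳ x)) (h p)
#*≤ (no _)      h = z≤n

1≤# : ∀ {P : Set} (P? : Dec P) → P → 1 ≤ #[ P? ]
1≤# (yes _) p = ≤-refl
1≤# (no ¬p) p = ⊥-elim (¬p p)

length-filter : ∀ {A : Set} {P : A → Set} (P? : ∀ x → Dec (P x)) xs →
                length (filter P? xs) ≡ ∑ xs (λ x → #[ P? x ])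
length-filter P? []       = refl
length-filter P? (x ∷ xs) with does (P? x)
... | true  = cong suc (length-filter P? xs)
... | false = length-filter P? xs

unique⇒lookup-injective : ∀ {A : Set} {xs : List A} → Unique xs →
                          ∀ {i j} → List.lookup xs i ≡ List.lookup xs j → i ≡ j
unique⇒lookup-injective (x∉ ∷ u) {zero}  {zero}  eq = refl
unique⇒lookup-injective (x∉ ∷ u) {zero}  {suc j} eq = ⊥-elim (All.lookup x∉ (∈-lookup j) eq)
unique⇒lookup-injective (x∉ ∷ u) {suc i} {zero}  eq = ⊥-elim (All.lookup x∉ (∈-lookup i) (sym eq))
unique⇒lookup-injective (x∉ ∷ u) {suc i} {suc j} eq = cong suc (unique⇒lookup-injective u eq)

-- Pigeonhole: `filter` keeps the list free of repetitions, and `f` is injective on what is kept.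
∑-indicator≤ : ∀ {A : Set} {P : A → Set} {xs c} → Unique xs → (P? : ∀ x → Dec (P x)) →
               (f : A → Fin c) → (∀ {x y} → P x → P y → f x ≡ f y → x ≡ y) →
               ∑ xs (λ x → #[ P? x ]) ≤ c
∑-indicator≤ {P = P} {xs} {c} u P? f inj = subst (_≤ c) (length-filter P? xs)
  (Fin.injective⇒≤ {f = λ i → f (List.lookup ys i)} λ {i} {j} eq →
     unique⇒lookup-injective (Unique.filter⁺ P? u) (inj (P-lookup i) (P-lookup j) eq))
  where
  ys = filter P? xs
  P-lookup : ∀ i → P (List.lookup ys i)
  P-lookup i = proj₂ (∈-filter⁻ P? {xs = xs} (∈-lookup i))

-- Each `f i` has its own position in `xs` filtered by `1 ≤ F x`, and every position left there adds
-- at least 1 to the sum.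
injective⇒≤∑ : ∀ {A : Set} {t} {xs : List A} (F : A → ℕ) (f : Fin t → A) → Injective _≡_ _≡_ f →
               (∀ i → f i ∈ xs) → (∀ i → 1 ≤ F (f i)) → t ≤ ∑ xs F
injective⇒≤∑ {A} {t} {xs} F f inj f∈ 1≤F = begin
  t                                ≤⟨ Fin.injective⇒≤ {f = λ i → Any.index (f∈ys i)}
                                        (λ {i} {j} eq → inj (index-injective (setoid A) (f∈ys i) (f∈ys j) eq)) ⟩
  length (filter F? xs)            ≡⟨ length-filter F? xs ⟩
  ∑ xs (λ x → #[ F? x ])           ≤⟨ ∑-mono xs (λ x → #≤ (F? x) id) ⟩
  ∑ xs F                           ∎
  where
  open ≤-Reasoning
  F? : ∀ x → Dec (1 ≤ F x)
  F? x = 1 ≤? F x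
  f∈ys : ∀ i → f i ∈ filter F? xs
  f∈ys i = ∈-filter⁺ F? (f∈ i) (1≤F i)

-- Sums over all vectors of a given length

vectors : ∀ {A : Set} → List A → ∀ a → List (Vec A a)
vectors xs zero    = [] ∷ []
vectors xs (suc a) = cartesianProductWith _∷_ xs (vectors xs a)

module _ {A : Set} (xs : List A) where

  length-vectors : ∀ a → length (vectors xs a) ≡ length xs ^ a
  length-vectors zero    = refl
  length-vectors (suc a) =
    trans (length-product _∷_ xs (vectors xs a)) (cong (length xs *_) (length-vectors a))

  ∈-vectors : (∀ x → x ∈ xs) → ∀ {a} (V : Vec A a) → V ∈ vectors xs a
  ∈-vectors all []      = here refl
  ∈-vectors all (x ∷ V) = ∈-cartesianProductWith⁺ _∷_ (all x) (∈-vectors all V)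

  -- Each vector of length `a` is the prefix of `length xs ^ (b ∸ a)` vectors of length `b`.
  ∑-truncate : ∀ {a b} (a≤b : a ≤ b) (g : Vec A a → ℕ) →
               ∑ (vectors xs b) (g ∘ truncate a≤b) ≡ length xs ^ (b ∸ a) * ∑ (vectors xs a) g
  ∑-truncate {b = b} z≤n g = begin
    ∑ (vectors xs b) (λ _ → g [])      ≡⟨ ∑-const (vectors xs b) (g []) ⟩
    length (vectors xs b) * g []       ≡⟨ cong₂ _*_ (length-vectors b) (sym (+-identityʳ _)) ⟩
    length xs ^ b * (g [] + 0)         ∎
    where open ≡-Reasoning
  ∑-truncate {suc a} {suc b} (s≤s a≤b) g = begin
    ∑ (vectors xs (suc b)) (g ∘ truncate (s≤s a≤b))
      ≡⟨ ∑-product _∷_ xs (vectors xs b) _ ⟩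
    ∑ xs (λ x → ∑ (vectors xs b) (λ V → g (x ∷ truncate a≤b V)))
      ≡⟨ ∑-cong xs (λ x → ∑-truncate a≤b (g ∘ (x ∷_))) ⟩
    ∑ xs (λ x → length xs ^ (b ∸ a) * ∑ (vectors xs a) (λ V → g (x ∷ V)))
      ≡⟨ ∑-* (length xs ^ (b ∸ a)) xs _ ⟩
    length xs ^ (b ∸ a) * ∑ xs (λ x → ∑ (vectors xs a) (λ V → g (x ∷ V)))
      ≡⟨ cong (length xs ^ (b ∸ a) *_) (∑-product _∷_ xs (vectors xs a) g) ⟨
    length xs ^ (b ∸ a) * ∑ (vectors xs (suc a)) g ∎
    where open ≡-Reasoning

  -- Exchangeability of the entries: taking out the entry at `k` matches the vectors of length
  -- `suc a` with the pairs of an entry and a vector of length `a`, whichever `k` is chosen.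
  ∑-removeAt : ∀ {a} (k : Fin (suc a)) (h : A → Vec A a → ℕ) →
               ∑ (vectors xs (suc a)) (λ V → h (lookup V k) (removeAt V k))
               ≡ ∑ xs λ x → ∑ (vectors xs a) λ V → h x V
  ∑-removeAt {a} zero h = ∑-product _∷_ xs (vectors xs a) _
  ∑-removeAt {suc a} (suc k) h = begin
    ∑ (vectors xs (suc (suc a))) (λ V → h (lookup V (suc k)) (removeAt V (suc k)))
      ≡⟨ ∑-product _∷_ xs (vectors xs (suc a)) _ ⟩
    ∑ xs (λ y → ∑ (vectors xs (suc a)) λ V → h (lookup V k) (removeAt (y ∷ V) (suc k)))
      -- `removeAt (y ∷ V) (suc k)` reduces only once `V` is visibly nonempty.
      ≡⟨ ∑-cong xs (λ y → ∑-cong (vectors xs (suc a)) λ { V@(_ ∷ _) → refl }) ⟩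
    ∑ xs (λ y → ∑ (vectors xs (suc a)) λ V → h (lookup V k) (y ∷ removeAt V k))
      ≡⟨ ∑-cong xs (λ y → ∑-removeAt k (λ x V → h x (y ∷ V))) ⟩
    ∑ xs (λ y → ∑ xs λ x → ∑ (vectors xs a) λ V → h x (y ∷ V))
      ≡⟨ ∑-swap xs xs _ ⟩
    ∑ xs (λ x → ∑ xs λ y → ∑ (vectors xs a) λ V → h x (y ∷ V))
      ≡⟨ ∑-cong xs (λ x → ∑-product _∷_ xs (vectors xs a) (h x)) ⟨
    ∑ xs (λ x → ∑ (vectors xs (suc a)) (h x)) ∎
    where open ≡-Reasoning

-- Distinct vectors

record Classes {A : Set} {n} (v : Fin n → A) : Set where
  field
    size          : ℕ
    class         : Fin n → Fin size
    rep           : Fin size → Fin n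
    -- `class-sound` makes `size` at least the number of values of `v`, and `rep-injective` makes it
    -- at most that number.
    class-sound   : ∀ {i j} → class i ≡ class j → v i ≡ v j
    rep-injective : ∀ {k l} → v (rep k) ≡ v (rep l) → k ≡ l

classes : ∀ {b n} (v : Fin n → Vec Bool b) → Classes v
classes {n = zero} v = record
  { size = 0 ; class = λ () ; rep = λ () ; class-sound = λ { {()} } ; rep-injective = λ { {()} } }
classes {b} {suc n} v = extend (Fin.any? λ p → Vec.≡-dec Bool._≟_ (v zero) (v (suc p)))
  where
  open Classes (classes (v ∘ suc))
  extend : Dec (∃ λ p → v zero ≡ v (suc p)) → Classes v
  extend (yes (p , eq)) = record
    { size          = size
    ; class         = λ { zero → class p ; (suc i) → class i }
    ; rep           = suc ∘ rep
    ; class-sound   = λ { {zero}  {zero}  _ → refl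
                        ; {zero}  {suc j} e → trans eq (class-sound e)
                        ; {suc i} {zero}  e → trans (class-sound e) (sym eq)
                        ; {suc i} {suc j} e → class-sound e }
    ; rep-injective = rep-injective
    }
  extend (no ∄p) = record
    { size          = suc size
    ; class         = λ { zero → zero ; (suc i) → suc (class i) }
    ; rep           = λ { zero → zero ; (suc k) → suc (rep k) }
    ; class-sound   = λ { {zero}  {zero}  _ → refl
                        ; {suc i} {suc j} e → class-sound (Fin.suc-injective e) }
    ; rep-injective = λ { {zero}  {zero}  _ → refl
                        ; {zero}  {suc l} e → ⊥-elim (∄p (rep l , e))
                        ; {suc k} {zero}  e → ⊥-elim (∄p (rep k , sym e))
                        ; {suc k} {suc l} e → cong suc (rep-injective e) }
    }

distinct : ∀ {b n} → (Fin n → Vec Bool b) → ℕ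
distinct v = Classes.size (classes v)

-- Indices told apart by `v` are still told apart by `w` after `φ`, so representatives for `v` land
-- in different classes of `w`.
distinct-mono : ∀ {a b m n} (v : Fin m → Vec Bool a) (w : Fin n → Vec Bool b) (φ : Fin m → Fin n) →
                (∀ i j → w (φ i) ≡ w (φ j) → v i ≡ v j) → distinct v ≤ distinct w
distinct-mono v w φ h = Fin.injective⇒≤ {f = λ k → W.class (φ (V.rep k))} λ e →
  V.rep-injective (h _ _ (W.class-sound e))
  where
  module V = Classes (classes v)
  module W = Classes (classes w)

1≤distinct : ∀ {b n} (v : Fin n → Vec Bool b) → 1 ≤ n → 1 ≤ distinct v
1≤distinct v (s≤s _) with distinct v | Classes.class (classes v) zero
... | suc _ | _ = s≤s z≤n

Alone : ∀ {b n} → (Fin n → Vec Bool b) → Fin n → Set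
Alone v k = ∀ j → v k ≡ v j → k ≡ j

abstract
  alone? : ∀ {b n} (v : Fin n → Vec Bool b) k → Dec (Alone v k)
  alone? v k = Fin.all? λ j → Vec.≡-dec Bool._≟_ (v k) (v j) →-dec (k Fin.≟ j)

-- Fix one solitary k₀ with Q k₀.  Any other solitary index is determined by its
-- class in w k₀, the family obtained from v by deleting k₀.
leave-one-out : ∀ {b n t} (v : Fin (suc n) → Vec Bool b) (w : Fin (suc n) → Fin n → Vec Bool b)
                {Q : Fin (suc n) → Set} (Q? : ∀ k → Dec (Q k)) →
                (∀ k {j} (k≢j : k ≢ j) → w k (punchOut k≢j) ≡ v j) →
                (∀ k → Q k → distinct (w k) ≤ t) →
                ∑ (allFin (suc n)) (λ k → #[ alone? v k ×-dec Q? k ]) ≤ suc t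
leave-one-out {n = n} {t} v w {Q} Q? w≡v few = go (Fin.any? λ k → alone? v k ×-dec Q? k)
  where
  go : Dec (∃ λ k → Alone v k × Q k) → ∑ (allFin (suc n)) (λ k → #[ alone? v k ×-dec Q? k ]) ≤ suc t
  go (no ∄k) = ≤-trans
    (∑-mono (allFin (suc n)) {g = λ _ → 0} λ k → #≤ (alone? v k ×-dec Q? k) λ q → ⊥-elim (∄k (k , q)))
    (≤-trans (≤-reflexive (∑-zero (allFin (suc n)))) z≤n)
  go (yes (k₀ , _ , q₀)) = ≤-trans
    (∑-indicator≤ (Unique.allFin⁺ (suc n)) (λ k → alone? v k ×-dec Q? k) f f-injective)
    (s≤s (few k₀ q₀))
    where
    open Classes (classes (w k₀))
    code : ∀ k → Dec (k₀ ≡ k) → Fin (suc size)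
    code k (yes _)   = zero
    code k (no k₀≢k) = suc (class (punchOut k₀≢k))
    f : Fin (suc n) → Fin (suc size)
    f k = code k (k₀ Fin.≟ k)
    code-injective : ∀ {k l} d e → Alone v k → code k d ≡ code l e → k ≡ l
    code-injective (yes refl) (yes refl) _ _ = refl
    code-injective (no k≢) (no l≢) alone e =
      alone _ (trans (sym (w≡v k₀ k≢)) (trans (class-sound (Fin.suc-injective e)) (w≡v k₀ l≢)))
    f-injective : ∀ {k l} → Alone v k × Q k → Alone v l × Q l → f k ≡ f l → k ≡ l
    f-injective (alone , _) _ = code-injective (k₀ Fin.≟ _) (k₀ Fin.≟ _) alone

-- Kleitman's correlation inequality

subsets : ∀ d → List (Subset d)
subsets = vectors (true ∷ false ∷ [])

∈-subsets : ∀ {d} (p : Subset d) → p ∈ subsets d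
∈-subsets = ∈-vectors _ λ { true → here refl ; false → there (here refl) }

∑-subsets : ∀ d (f : Subset (suc d) → ℕ) →
            ∑ (subsets (suc d)) f ≡ ∑ (subsets d) (f ∘ (true ∷_)) + ∑ (subsets d) (f ∘ (false ∷_))
∑-subsets d f = trans (∑-product _∷_ (true ∷ false ∷ []) (subsets d) f)
                      (cong (∑ (subsets d) (f ∘ (true ∷_)) +_) (+-identityʳ _))

Antitone : ∀ {d} → (Subset d → ℕ) → Set
Antitone f = ∀ {p q} → p ⊆ q → f q ≤ f p

-- Chebyshev's sum inequality for two terms: with `b = a + x` and `d = c + y`, the right side
-- exceeds the left by `x * y`.
chebyshev : ∀ {a b c d} → a ≤ b → c ≤ d → (a + b) * (c + d) ≤ 2 * (a * c + b * d)
chebyshev {a} {c = c} a≤b c≤d with m≤n⇒∃[o]m+o≡n a≤b | m≤n⇒∃[o]m+o≡n c≤d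
... | x , refl | y , refl = ≤-trans (m≤m+n _ (x * y)) (≤-reflexive (expand a c x y))
  where
  expand : ∀ a c x y → (a + (a + x)) * (c + (c + y)) + x * y ≡ 2 * (a * c + (a + x) * (c + y))
  expand = solve-∀

-- Induction on `d`, splitting the subsets by their first element. Dropping that element can only
-- raise antitone functions, so `chebyshev` compares the sums over the two halves, and the induction
-- hypothesis applies to each half.
kleitman : ∀ d {f g : Subset d → ℕ} → Antitone f → Antitone g →
           ∑ (subsets d) f * ∑ (subsets d) g ≤ 2 ^ d * ∑ (subsets d) (λ p → f p * g p)
kleitman zero    {f} {g} _ _ = ≤-reflexive (unit (f []) (g []))
  where
  unit : ∀ x y → (x + 0) * (y + 0) ≡ x * y + 0 + 0
  unit = solve-∀
kleitman (suc d) {f} {g} f↓ g↓ = begin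
  ∑ (subsets (suc d)) f * ∑ (subsets (suc d)) g
    ≡⟨ cong₂ _*_ (∑-subsets d f) (∑-subsets d g) ⟩
  (∑ S f₁ + ∑ S f₀) * (∑ S g₁ + ∑ S g₀)
    ≤⟨ chebyshev (∑-mono S λ p → f↓ (out⊆ {p = p} {q = p} id)) (∑-mono S λ p → g↓ (out⊆ {p = p} {q = p} id)) ⟩
  2 * (∑ S f₁ * ∑ S g₁ + ∑ S f₀ * ∑ S g₀)
    ≤⟨ *-monoʳ-≤ 2 (+-mono-≤ (kleitman d (f↓ ∘ s⊆s) (g↓ ∘ s⊆s)) (kleitman d (f↓ ∘ s⊆s) (g↓ ∘ s⊆s))) ⟩
  2 * (2 ^ d * ∑ S (λ p → f₁ p * g₁ p) + 2 ^ d * ∑ S (λ p → f₀ p * g₀ p))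
    ≡⟨ factor (2 ^ d) (∑ S (λ p → f₁ p * g₁ p)) (∑ S (λ p → f₀ p * g₀ p)) ⟩
  2 ^ suc d * (∑ S (λ p → f₁ p * g₁ p) + ∑ S (λ p → f₀ p * g₀ p))
    ≡⟨ cong (2 ^ suc d *_) (∑-subsets d (λ p → f p * g p)) ⟨
  2 ^ suc d * ∑ (subsets (suc d)) (λ p → f p * g p) ∎
  where
  open ≤-Reasoning
  S = subsets d
  f₁ = f ∘ (true ∷_)
  f₀ = f ∘ (false ∷_)
  g₁ = g ∘ (true ∷_)
  g₀ = g ∘ (false ∷_)
  factor : ∀ x y z → 2 * (x * y + x * z) ≡ 2 * x * (y + z)
  factor = solve-∀

-- Sums over `Fin n`, and the number of small subsets

∑-tabulate : ∀ {A : Set} {n} (g : Fin n → A) (f : A → ℕ) →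
             ∑ (List.tabulate g) f ≡ Vec.sum (tabulate (f ∘ g))
∑-tabulate {n = zero}  g f = refl
∑-tabulate {n = suc n} g f = cong (f (g zero) +_) (∑-tabulate (g ∘ suc) f)

∑-allFin : ∀ {n} (f : Fin n → ℕ) → ∑ (allFin n) f ≡ Vec.sum (tabulate f)
∑-allFin = ∑-tabulate id

∑-allFin-suc : ∀ {n} (f : Fin (suc n) → ℕ) → ∑ (allFin (suc n)) f ≡ f zero + ∑ (allFin n) (f ∘ suc)
∑-allFin-suc f = trans (∑-allFin f) (cong (f zero +_) (sym (∑-allFin (f ∘ suc))))

length-allFin : ∀ n → length (allFin n) ≡ n
length-allFin n = List.length-tabulate {n = n} id

∑-allFin-const : ∀ n {c} → ∑ (allFin n) (λ _ → c) ≡ n * c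
∑-allFin-const n {c} = trans (∑-const (allFin n) c) (cong (_* c) (length-allFin n))

term≤∑ : ∀ {n} (f : Fin n → ℕ) i → f i ≤ ∑ (allFin n) f
term≤∑ f zero    = ≤-trans (m≤m+n _ _) (≤-reflexive (sym (∑-allFin-suc f)))
term≤∑ f (suc i) = ≤-trans (term≤∑ (f ∘ suc) i)
                    (≤-trans (m≤n+m _ (f zero)) (≤-reflexive (sym (∑-allFin-suc f))))

-- Pascal's rule: the two summands count the subsets with and without the first element.
∑-layer : ∀ d i → ∑ (subsets d) (λ p → #[ ∣ p ∣ ≟ i ]) ≡ d C i
∑-layer zero    zero    = refl
∑-layer zero    (suc i) = refl
∑-layer (suc d) zero    = begin
  ∑ (subsets (suc d)) (λ p → #[ ∣ p ∣ ≟ 0 ])                     ≡⟨ ∑-subsets d _ ⟩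
  ∑ (subsets d) (λ _ → 0) + ∑ (subsets d) (λ p → #[ ∣ p ∣ ≟ 0 ]) ≡⟨ cong₂ _+_ (∑-zero (subsets d)) (∑-layer d 0) ⟩
  1                                                              ∎
  where open ≡-Reasoning
∑-layer (suc d) (suc i) =
  trans (∑-subsets d _) (trans (cong₂ _+_ (∑-layer d i) (∑-layer d (suc i))) (nCk+nC[k+1]≡[n+1]C[k+1] d i))

-- A small subset is counted in the layer of its own size.
∑-small : ∀ d s → ∑ (subsets d) (λ p → #[ ∣ p ∣ ≤? s ]) ≤ d C≤ s
∑-small d s = begin
  ∑ (subsets d) (λ p → #[ ∣ p ∣ ≤? s ])
    ≤⟨ ∑-mono (subsets d) (λ p → #≤ (∣ p ∣ ≤? s) λ ∣p∣≤s →
         ≤-trans (1≤# (∣ p ∣ ≟ toℕ (fromℕ< (s≤s ∣p∣≤s))) (sym (Fin.toℕ-fromℕ< _)))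
                 (term≤∑ (λ i → #[ ∣ p ∣ ≟ toℕ i ]) (fromℕ< (s≤s ∣p∣≤s)))) ⟩
  ∑ (subsets d) (λ p → ∑ (allFin (suc s)) (λ i → #[ ∣ p ∣ ≟ toℕ i ]))
    ≡⟨ ∑-swap (subsets d) (allFin (suc s)) _ ⟩
  ∑ (allFin (suc s)) (λ i → ∑ (subsets d) (λ p → #[ ∣ p ∣ ≟ toℕ i ]))
    ≡⟨ ∑-cong (allFin (suc s)) (λ i → ∑-layer d (toℕ i)) ⟩
  ∑ (allFin (suc s)) (λ i → d C toℕ i)
    ≡⟨ ∑-allFin {suc s} (λ i → d C toℕ i) ⟩
  d C≤ s ∎
  where open ≤-Reasoning

nonempty : ∀ {d} (p : Subset d) → 1 ≤ ∣ p ∣ → ∃ λ k → lookup p k ≡ true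
nonempty (true  ∷ p) _ = zero , refl
nonempty (false ∷ p) h = map suc id (nonempty p h)

1≤∣∣ : ∀ {d} (p : Subset d) {k} → lookup p k ≡ true → 1 ≤ ∣ p ∣
1≤∣∣ (true  ∷ p)         _ = s≤s z≤n
1≤∣∣ (false ∷ p) {suc k} h = 1≤∣∣ p h

empty : ∀ d → ∣ tabulate {n = d} (λ _ → false) ∣ ≡ 0
empty zero    = refl
empty (suc d) = empty d

-- Covers by rectangles

∧-true : ∀ {x y} → x ∧ y ≡ true → x ≡ true × y ≡ true
∧-true {true} {true} _ = refl , refl

module _ {s n m r} {M : Matrix n m} {I : Fin r → Subset n} {J : Fin r → Subset m} (cover : IsCover s M I J) where
  open IsCover cover

  private
    R : Fin n → Fin m → Subset r
    R = rectanglesAt I J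

  rectangle⇒one : ∀ {i j k} → lookup (R i j) k ≡ true → M i j ≡ true
  rectangle⇒one {i} {j} {k} eq = monochromatic k i j (Vec.lookup⇒[]= i (I k) (proj₁ both)) (Vec.lookup⇒[]= j (J k) (proj₂ both))
    where
    both : lookup (I k) i ≡ true × lookup (J k) j ≡ true
    both = ∧-true (trans (sym (Vec.lookup∘tabulate (λ k → lookup (I k) i ∧ lookup (J k) j) k)) eq)

  one⇒rectangle : ∀ {i j} → M i j ≡ true → ∃ λ k → lookup (R i j) k ≡ true
  one⇒rectangle {i} {j} eq = nonempty (R i j) (covered i j eq)

  -- If some rectangle contains the entry, then the entry is 1 and `multiplicity` applies; otherwise
  -- the size is 0.
  ∣R∣≤s : ∀ i j → ∣ R i j ∣ ≤ s
  ∣R∣≤s i j with 1 ≤? ∣ R i j ∣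
  ... | yes 1≤ = multiplicity i j (rectangle⇒one (proj₂ (nonempty (R i j) 1≤)))
  ... | no  1≰ = ≤-trans (s≤s⁻¹ (≰⇒> 1≰)) z≤n

mkCover : ∀ {s n m r} {M : Matrix n m} {I : Fin r → Subset n} {J : Fin r → Subset m} →
          (∀ k i j → lookup (I k) i ≡ true → lookup (J k) j ≡ true → M i j ≡ true) →
          (∀ i j → M i j ≡ true → 1 ≤ ∣ rectanglesAt I J i j ∣ × ∣ rectanglesAt I J i j ∣ ≤ s) →
          IsCover s M I J
mkCover mono count = record
  { monochromatic = λ k i j i∈ j∈ → mono k i j (Vec.[]=⇒lookup i∈) (Vec.[]=⇒lookup j∈)
  ; covered       = λ i j eq → proj₁ (count i j eq)
  ; multiplicity  = λ i j eq → proj₂ (count i j eq)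
  }

module _ {s n m r} {M : Matrix n m} {I : Fin r → Subset n} {J : Fin r → Subset m} (cover : IsCover s M I J) where
  open IsCover cover

  cover-one : ∀ k i j → lookup (I k) i ≡ true → lookup (J k) j ≡ true → M i j ≡ true
  cover-one k i j i∈ j∈ = monochromatic k i j (Vec.lookup⇒[]= i (I k) i∈) (Vec.lookup⇒[]= j (J k) j∈)

  cover-count : ∀ i j → M i j ≡ true → 1 ≤ ∣ rectanglesAt I J i j ∣ × ∣ rectanglesAt I J i j ∣ ≤ s
  cover-count i j eq = covered i j eq , multiplicity i j eq

  -- Invariance under pointwise equality, on which the exhaustive search over `I` and `J` relies.
  cover-resp : ∀ {I′ J′} → (∀ k → I k ≡ I′ k) → (∀ k → J k ≡ J′ k) → IsCover s M I′ J′
  cover-resp {I′} {J′} I≡ J≡ = mkCover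
    (λ k i j i∈ j∈ → cover-one k i j (trans (cong (λ p → lookup p i) (I≡ k)) i∈) (trans (cong (λ p → lookup p j) (J≡ k)) j∈))
    (λ i j eq → subst (λ R → 1 ≤ ∣ R ∣ × ∣ R ∣ ≤ s)
      (Vec.tabulate-cong λ k → cong₂ (λ p q → lookup p i ∧ lookup q j) (I≡ k) (J≡ k)) (cover-count i j eq))

cover-cong : ∀ {s n m r} {M M′ : Matrix n m} → (∀ i j → M i j ≡ M′ i j) → HasCover s M r → HasCover s M′ r
cover-cong M≡ (I , J , cover) = I , J , mkCover
  (λ k i j i∈ j∈ → trans (sym (M≡ i j)) (cover-one cover k i j i∈ j∈))
  (λ i j eq → cover-count cover i j (trans (M≡ i j) eq))

cover-flip : ∀ {s n m r} {M : Matrix n m} → HasCover s M r → HasCover s (flip M) r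
cover-flip {s} (I , J , cover) = J , I , mkCover
  (λ k j i j∈ i∈ → cover-one cover k i j i∈ j∈)
  (λ j i eq → subst (λ R → 1 ≤ ∣ R ∣ × ∣ R ∣ ≤ s)
    (Vec.tabulate-cong λ k → Bool.∧-comm (lookup (I k) i) (lookup (J k) j)) (cover-count cover i j eq))

-- Partial maps serve two uses: total ones restrict a matrix to a submatrix, while the prediction
-- leaves undefined the rows and columns that match nothing in the sample.
pull : ∀ {n m a b} → (Fin n → Maybe (Fin a)) → (Fin m → Maybe (Fin b)) → Matrix a b → Matrix n m
pull f g M i j = maybe′ (λ x → maybe′ (M x) false (g j)) false (f i)

-- Preimages of rectangles are rectangles. Where both maps are defined the rectangles at `(i , j)`
-- are those at its image; elsewhere the entry is 0.
cover-pull : ∀ {s n m a b r} (f : Fin n → Maybe (Fin a)) (g : Fin m → Maybe (Fin b)) {M : Matrix a b} →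
             HasCover s M r → HasCover s (pull f g M) r
cover-pull {s} {r = r} f g {M} (I , J , cover) =
  I′ , J′ , mkCover mono count
  where
  -- The indicators before tabulation, which compute when `f i` and `g j` are split.
  I″ = λ k i → maybe′ (lookup (I k)) false (f i)
  J″ = λ k j → maybe′ (lookup (J k)) false (g j)
  I′ = λ k → tabulate (I″ k)
  J′ = λ k → tabulate (J″ k)
  R≡ : ∀ i j → tabulate (λ k → I″ k i ∧ J″ k j) ≡ rectanglesAt I′ J′ i j
  R≡ i j = Vec.tabulate-cong λ k → sym (cong₂ _∧_ (Vec.lookup∘tabulate (I″ k) i) (Vec.lookup∘tabulate (J″ k) j))
  mono″ : ∀ k i j → I″ k i ≡ true → J″ k j ≡ true → pull f g M i j ≡ true
  mono″ k i j with f i | g j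
  ... | just x  | just y  = cover-one cover k x y
  ... | just x  | nothing = λ _ ()
  ... | nothing | _       = λ ()
  mono : ∀ k i j → lookup (I′ k) i ≡ true → lookup (J′ k) j ≡ true → pull f g M i j ≡ true
  mono k i j i∈ j∈ = mono″ k i j (trans (sym (Vec.lookup∘tabulate (I″ k) i)) i∈) (trans (sym (Vec.lookup∘tabulate (J″ k) j)) j∈)
  count″ : ∀ i j → pull f g M i j ≡ true →
           1 ≤ ∣ tabulate (λ k → I″ k i ∧ J″ k j) ∣ × ∣ tabulate (λ k → I″ k i ∧ J″ k j) ∣ ≤ s
  count″ i j with f i | g j
  ... | just x  | just y  = cover-count cover x y
  ... | just x  | nothing = λ ()
  ... | nothing | _       = λ ()
  count : ∀ i j → pull f g M i j ≡ true → 1 ≤ ∣ rectanglesAt I′ J′ i j ∣ × ∣ rectanglesAt I′ J′ i j ∣ ≤ s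
  count i j eq = subst (λ R → 1 ≤ ∣ R ∣ × ∣ R ∣ ≤ s) (R≡ i j) (count″ i j eq)

-- An empty rectangle may always be added.
cover-suc : ∀ {s n m r} {M : Matrix n m} → HasCover s M r → HasCover s M (suc r)
cover-suc {s} {n} {m} {r} {M} (I , J , cover) = I′ , J′ , mkCover mono count
  where
  I′ : Fin (suc r) → Subset n
  I′ zero    = Sub.⊥
  I′ (suc k) = I k
  J′ : Fin (suc r) → Subset m
  J′ zero    = Sub.⊥
  J′ (suc k) = J k
  mono : ∀ k i j → lookup (I′ k) i ≡ true → lookup (J′ k) j ≡ true → M i j ≡ true
  mono zero    i j i∈ = case trans (sym (Vec.lookup-replicate i false)) i∈ of λ ()
  mono (suc k) i j    = cover-one cover k i j
  count : ∀ i j → M i j ≡ true → 1 ≤ ∣ rectanglesAt I′ J′ i j ∣ × ∣ rectanglesAt I′ J′ i j ∣ ≤ s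
  count i j eq rewrite Vec.lookup-replicate i false = cover-count cover i j eq

cover-mono : ∀ {s n m r r′} {M : Matrix n m} → r ≤ r′ → HasCover s M r → HasCover s M r′
cover-mono {s} {M = M} r≤r′ cover = go (≤⇒≤′ r≤r′)
  where
  go : ∀ {r′} → _ ≤′ r′ → HasCover s M r′
  go (≤′-reflexive refl) = cover
  go (≤′-step r≤)        = cover-suc {M = M} (go r≤)

-- Remove row `i₀` from every rectangle and add one rectangle made of this row and the ones of `M′`
-- in it. The entries of that row are then covered once, which `1 ≤ s` permits.
cover-change-row : ∀ {s n m r} {M M′ : Matrix n m} i₀ → 1 ≤ s → (∀ i j → i ≢ i₀ → M i j ≡ M′ i j) →
                   HasCover s M r → HasCover s M′ (suc r)
cover-change-row {s} {n} {m} {r} {M} {M′} i₀ 1≤s M≡ (I , J , cover) = I′ , J′ , mkCover mono count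
  where
  ι : Fin (suc r) → Fin n → Bool
  ι zero    i = does (i Fin.≟ i₀)
  ι (suc k) i = if does (i Fin.≟ i₀) then false else lookup (I k) i
  I′ : Fin (suc r) → Subset n
  I′ k = tabulate (ι k)
  J′ : Fin (suc r) → Subset m
  J′ zero    = tabulate (M′ i₀)
  J′ (suc k) = J k
  mono″ : ∀ k i j → ι k i ≡ true → lookup (J′ k) j ≡ true → M′ i j ≡ true
  mono″ zero i j with i Fin.≟ i₀
  ... | yes refl = λ _ j∈ → trans (sym (Vec.lookup∘tabulate (M′ i₀) j)) j∈
  ... | no i≢i₀  = λ ()
  mono″ (suc k) i j with i Fin.≟ i₀
  ... | yes refl = λ ()
  ... | no i≢i₀  = λ i∈ j∈ → trans (sym (M≡ i j i≢i₀)) (cover-one cover k i j i∈ j∈)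
  mono : ∀ k i j → lookup (I′ k) i ≡ true → lookup (J′ k) j ≡ true → M′ i j ≡ true
  mono k i j i∈ = mono″ k i j (trans (sym (Vec.lookup∘tabulate (ι k) i)) i∈)
  R″ : Fin n → Fin m → Subset (suc r)
  R″ i j = (ι zero i ∧ M′ i₀ j) ∷ tabulate (λ k → ι (suc k) i ∧ lookup (J k) j)
  R≡ : ∀ i j → R″ i j ≡ rectanglesAt I′ J′ i j
  R≡ i j = cong₂ _∷_
    (sym (cong₂ _∧_ (Vec.lookup∘tabulate (ι zero) i) (Vec.lookup∘tabulate (M′ i₀) j)))
    (Vec.tabulate-cong λ k → sym (cong (_∧ lookup (J k) j) (Vec.lookup∘tabulate (ι (suc k)) i)))
  count″ : ∀ i j → M′ i j ≡ true → 1 ≤ ∣ R″ i j ∣ × ∣ R″ i j ∣ ≤ s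
  count″ i j eq with i Fin.≟ i₀
  ... | yes refl rewrite eq | empty r = s≤s z≤n , 1≤s
  ... | no i≢i₀ = cover-count cover i j (trans (M≡ i j i≢i₀) eq)
  count : ∀ i j → M′ i j ≡ true → 1 ≤ ∣ rectanglesAt I′ J′ i j ∣ × ∣ rectanglesAt I′ J′ i j ∣ ≤ s
  count i j eq = subst (λ R → 1 ≤ ∣ R ∣ × ∣ R ∣ ≤ s) (R≡ i j) (count″ i j eq)

-- A path from `M` to `N` along which consecutive matrices differ in one row only, so that by
-- `cover-change-row` each step costs at most one rectangle.
hybrid : ∀ {n m} → Matrix n m → Matrix n m → ℕ → Matrix n m
hybrid M N t i j = if does (toℕ i <? t) then N i j else M i j

hybrid-above : ∀ {n m} (M N : Matrix n m) {t} i j → toℕ i < t → hybrid M N t i j ≡ N i j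
hybrid-above M N {t} i j i<t = cong (if_then N i j else M i j) (dec-true (toℕ i <? t) i<t)

hybrid-below : ∀ {n m} (M N : Matrix n m) {t} i j → t ≤ toℕ i → hybrid M N t i j ≡ M i j
hybrid-below M N {t} i j t≤i = cong (if_then N i j else M i j) (dec-false (toℕ i <? t) (≤⇒≯ t≤i))

hybrid-suc : ∀ {s n m r t} (M N : Matrix n m) → 1 ≤ s → t < n →
             HasCover s (hybrid M N t) r → HasCover s (hybrid M N (suc t)) (suc r)
hybrid-suc {t = t} M N 1≤s t<n = cover-change-row (fromℕ< t<n) 1≤s agree
  where
  agree : ∀ i j → i ≢ fromℕ< t<n → hybrid M N t i j ≡ hybrid M N (suc t) i j
  agree i j i≢t with <-cmp (toℕ i) t
  ... | tri< i<t _ _ = trans (hybrid-above M N i j i<t) (sym (hybrid-above M N i j (m≤n⇒m≤1+n i<t)))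
  ... | tri≈ _ i≡t _ = ⊥-elim (i≢t (Fin.toℕ-injective (trans i≡t (sym (Fin.toℕ-fromℕ< t<n)))))
  ... | tri> _ _ i>t = trans (hybrid-below M N i j (<⇒≤ i>t)) (sym (hybrid-below M N i j i>t))

-- The path from the zero matrix to `M` takes `n` steps and starts from a cover by no rectangles.
cover-by-rows : ∀ {s n m} (M : Matrix n m) → 1 ≤ s → HasCover s M n
cover-by-rows {s} {n} {m} M 1≤s = cover-cong (λ i j → hybrid-above O M i j (Fin.toℕ<n i)) (go n ≤-refl)
  where
  O : Matrix n m
  O _ _ = false
  go : ∀ t → t ≤ n → HasCover s (hybrid O M t) t
  go zero    _   = (λ ()) , (λ ()) , mkCover (λ ()) (λ i j eq → case eq of λ ())
  go (suc t) t<n = hybrid-suc O M 1≤s t<n (go t (<⇒≤ t<n))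

cover-by-columns : ∀ {s n m} (M : Matrix n m) → 1 ≤ s → HasCover s M m
cover-by-columns M 1≤s = cover-flip (cover-by-rows (flip M) 1≤s)

-- Numbers of distinct rows and columns of a covered matrix

rows : ∀ {a b} → Matrix a b → ℕ
rows M = distinct (λ i → tabulate (M i))

cols : ∀ {a b} → Matrix a b → ℕ
cols M = rows (flip M)

tabulate-injective : ∀ {A : Set} {n} {f g : Fin n → A} → tabulate f ≡ tabulate g → ∀ i → f i ≡ g i
tabulate-injective {f = f} {g} eq i =
  trans (sym (Vec.lookup∘tabulate f i)) (trans (cong (λ v → lookup v i) eq) (Vec.lookup∘tabulate g i))

rows-mono : ∀ {a b a′ b′} (M : Matrix a b) (M′ : Matrix a′ b′) (φ : Fin a → Fin a′) (ψ : Fin b → Fin b′) →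
            (∀ i j → M i j ≡ M′ (φ i) (ψ j)) → rows M ≤ rows M′
rows-mono M M′ φ ψ M≡ = distinct-mono _ _ φ λ i i′ eq → Vec.tabulate-cong λ j →
  trans (M≡ i j) (trans (tabulate-injective eq (ψ j)) (sym (M≡ i′ j)))

module _ {s a b d} {M : Matrix a b} (hasCover : HasCover s M d) where
  private
    I = proj₁ hasCover
    J = proj₁ (proj₂ hasCover)
    cover = proj₂ (proj₂ hasCover)

  rectanglesOfRow : Fin a → Subset d
  rectanglesOfRow i = tabulate λ k → lookup (I k) i

  -- Indicator of the down-set generated by the rectangle sets of the rows. Closing downwards gives
  -- the monotonicity that Kleitman's inequality asks for.
  inRow : Subset d → ℕ
  inRow p = #[ Fin.any? (λ i → p ⊆? rectanglesOfRow i) ]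

  inRow-antitone : Antitone inRow
  inRow-antitone {p} {q} p⊆q = #≤ (Fin.any? λ i → q ⊆? rectanglesOfRow i) λ (i , q⊆) →
    1≤# (Fin.any? λ i → p ⊆? rectanglesOfRow i) (i , ⊆-trans {i = p} {j = q} {k = rectanglesOfRow i} p⊆q q⊆)

  one-resp : ∀ {i i′} → rectanglesOfRow i ≡ rectanglesOfRow i′ → ∀ j → M i j ≡ true → M i′ j ≡ true
  one-resp {i} {i′} eq j Mij with one⇒rectangle cover Mij
  ... | k , k∈ = rectangle⇒one cover {k = k} (trans (cong (λ R → lookup R k) (sym
    (Vec.tabulate-cong λ k → cong (_∧ lookup (J k) j) (tabulate-injective eq k)))) k∈)

  -- The ones of a row are the union of the column sets of its rectangles.
  row-determined : ∀ {i i′} → rectanglesOfRow i ≡ rectanglesOfRow i′ → ∀ j → M i j ≡ M i′ j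
  row-determined {i} {i′} eq j with M i j in e | M i′ j in e′
  ... | true  | true  = refl
  ... | false | false = refl
  ... | true  | false = trans (sym (one-resp eq j e)) e′
  ... | false | true  = trans (sym e) (one-resp (sym eq) j e′)

  -- Different rows have different rectangle sets by `row-determined`, and all these sets lie in the
  -- down-set.
  rows≤∑inRow : rows M ≤ ∑ (subsets d) inRow
  rows≤∑inRow = injective⇒≤∑ inRow (rectanglesOfRow ∘ rep)
    (λ eq → rep-injective (Vec.tabulate-cong (row-determined eq)))
    (λ k → ∈-subsets _)
    (λ k → 1≤# (Fin.any? (λ i → rectanglesOfRow (rep k) ⊆? rectanglesOfRow i)) (rep k , id))
    where open Classes (classes (λ i → tabulate (M i)))

  rows≤2^d : rows M ≤ 2 ^ d
  rows≤2^d = begin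
    rows M                    ≤⟨ rows≤∑inRow ⟩
    ∑ (subsets d) inRow           ≤⟨ ∑-mono (subsets d) (λ p → bit≤1 _) ⟩
    ∑ (subsets d) (λ _ → 1)   ≡⟨ length≡∑ (subsets d) ⟨
    length (subsets d)        ≡⟨ length-vectors _ d ⟩
    2 ^ d                     ∎
    where open ≤-Reasoning

-- A set in both down-sets lies in the rectangle set of some row `i` and of some column `j`, hence
-- among the rectangles at `(i , j)`, of which there are at most `s`. Kleitman's inequality turns
-- this count of common members into a bound on the product.
rows*cols≤ : ∀ {s a b d} {M : Matrix a b} → HasCover s M d → rows M * cols M ≤ (d C≤ s) * 2 ^ d
rows*cols≤ {s} {a} {b} {d} {M} hasCover@(I , J , cover) = begin
  rows M * cols M
    ≤⟨ *-mono-≤ (rows≤∑inRow hasCover) (rows≤∑inRow flipped) ⟩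
  ∑ (subsets d) (inRow hasCover) * ∑ (subsets d) (inRow flipped)
    ≤⟨ kleitman d (inRow-antitone hasCover) (inRow-antitone flipped) ⟩
  2 ^ d * ∑ (subsets d) (λ p → inRow hasCover p * inRow flipped p)
    ≤⟨ *-monoʳ-≤ (2 ^ d) (∑-mono (subsets d) small) ⟩
  2 ^ d * ∑ (subsets d) (λ p → #[ ∣ p ∣ ≤? s ])
    ≤⟨ *-monoʳ-≤ (2 ^ d) (∑-small d s) ⟩
  2 ^ d * (d C≤ s)
    ≡⟨ *-comm (2 ^ d) _ ⟩
  (d C≤ s) * 2 ^ d ∎
  where
  open ≤-Reasoning
  flipped : HasCover s (flip M) d
  flipped = cover-flip {M = M} hasCover
  small : ∀ p → inRow hasCover p * inRow flipped p ≤ #[ ∣ p ∣ ≤? s ]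
  small p with Fin.any? (λ i → p ⊆? rectanglesOfRow hasCover i) | Fin.any? (λ j → p ⊆? rectanglesOfRow flipped j)
  ... | no _         | _            = z≤n
  ... | yes _        | no _         = z≤n
  ... | yes (i , p⊆) | yes (j , p⊆′) = 1≤# (∣ p ∣ ≤? s) (≤-trans (p⊆q⇒∣p∣≤∣q∣ p⊆R) (∣R∣≤s cover i j))
    where
    value : ∀ {f : Fin d → Bool} {k} → k Sub.∈ tabulate f → f k ≡ true
    value {f} {k} k∈ = trans (sym (Vec.lookup∘tabulate f k)) (Vec.[]=⇒lookup k∈)
    p⊆R : p ⊆ rectanglesAt I J i j
    p⊆R {k} k∈p = Vec.lookup⇒[]= k _ (trans (Vec.lookup∘tabulate _ k) (cong₂ _∧_ (value (p⊆ k∈p)) (value (p⊆′ k∈p))))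

-- Deciding the ranks by exhaustive search

does-sound : ∀ {P : Set} (P? : Dec P) → does P? ≡ true → P
does-sound (yes p) _ = p

search : ∀ {A : Set} {P : A → Set} (xs : List A) → (∀ x → x ∈ xs) → (∀ x → Dec (P x)) → Dec (∃ P)
search xs complete P? = map′ Any.satisfied (λ (x , p) → lose (complete x) p) (Any.any? P? xs)

-- Functions are enumerated through their tables, so `P` has to respect pointwise equality.
searchΠ : ∀ {A : Set} {n} {P : (Fin n → A) → Set} (xs : List A) → (∀ x → x ∈ xs) →
          (∀ {f g} → f ≗ g → P f → P g) → (∀ f → Dec (P f)) → Dec (∃ P)
searchΠ {n = n} xs complete resp P? = map′
  (λ (v , p) → lookup v , p)
  (λ (f , p) → tabulate f , resp (λ i → sym (Vec.lookup∘tabulate f i)) p)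
  (search (vectors xs n) (∈-vectors xs complete) (P? ∘ lookup))

isCover? : ∀ s {n m r} (M : Matrix n m) (I : Fin r → Subset n) (J : Fin r → Subset m) → Dec (IsCover s M I J)
isCover? s M I J = map′ (λ (mono , count) → mkCover mono count) (λ cover → cover-one cover , cover-count cover)
  ((Fin.all? λ k → Fin.all? λ i → Fin.all? λ j →
      (lookup (I k) i Bool.≟ true) →-dec ((lookup (J k) j Bool.≟ true) →-dec (M i j Bool.≟ true)))
   ×-dec
   (Fin.all? λ i → Fin.all? λ j →
      (M i j Bool.≟ true) →-dec ((1 ≤? ∣ rectanglesAt I J i j ∣) ×-dec (∣ rectanglesAt I J i j ∣ ≤? s))))

abstract
  hasCover? : ∀ s {n m} (M : Matrix n m) r → Dec (HasCover s M r)
  hasCover? s {n} {m} M r =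
    searchΠ (subsets n) ∈-subsets (λ I≗ (J , cover) → J , cover-resp cover I≗ (λ _ → refl)) λ I →
    searchΠ (subsets m) ∈-subsets (λ J≗ cover → cover-resp cover (λ _ → refl) J≗) λ J →
    isCover? s M I J

atMost⇒cover : ∀ {s n m d} {M : Matrix n m} → BinaryRankAtMost s d M → HasCover s M d
atMost⇒cover {M = M} (r , (cover , _) , r≤d) = cover-mono {M = M} r≤d cover

-- `BinaryRankAtMost` asks for the rank itself, which is found by descending from `d` until one
-- rectangle fewer no longer suffices.
cover⇒atMost : ∀ {s n m} d {M : Matrix n m} → HasCover s M d → BinaryRankAtMost s d M
cover⇒atMost zero    cover = 0 , (cover , λ _ _ → z≤n) , z≤n
cover⇒atMost {s} (suc d) {M} cover with hasCover? s M d
... | yes cover′ = map id (map id m≤n⇒m≤1+n) (cover⇒atMost d {M} cover′)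
... | no ¬cover′ = suc d , (cover , minimal) , ≤-refl
  where
  minimal : ∀ r → HasCover s M r → suc d ≤ r
  minimal r c = ≰⇒> λ r≤d → ¬cover′ (cover-mono {M = M} r≤d c)

abstract
  atMost? : ∀ s d {n m} (M : Matrix n m) → Dec (BinaryRankAtMost s d M)
  atMost? s d M = map′ (cover⇒atMost d {M}) (atMost⇒cover {M = M}) (hasCover? s M d)

cover⇒exactly : ∀ {s n m d} {M : Matrix n m} → HasCover s M (suc d) → ¬ HasCover s M d →
                BinaryRankExactly s (suc d) M
cover⇒exactly {s} {d = d} {M} cover ¬cover =
  cover , λ r c → ≰⇒> λ r≤d → ¬cover (cover-mono {M = M} r≤d c)

abstract
  exactly? : ∀ s d {n m} (M : Matrix n m) → Dec (BinaryRankExactly s d M)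
  exactly? s zero    M = map′ (λ c → c , λ _ _ → z≤n) proj₁ (hasCover? s M 0)
  exactly? s (suc d) M = map′ (λ (c , ¬c) → cover⇒exactly {M = M} c ¬c) (λ (c , min) → c , λ c′ → 1+n≰n (min d c′))
    (hasCover? s M (suc d) ×-dec ¬? (hasCover? s M d))

-- Distance

_≐_ : ∀ {n m} → Matrix n m → Matrix n m → Set
M ≐ M′ = ∀ i j → M i j ≡ M′ i j

≐-sym : ∀ {n m} {M M′ : Matrix n m} → M ≐ M′ → M′ ≐ M
≐-sym M≐ i j = sym (M≐ i j)

exactly-resp : ∀ s d {n m} {M M′ : Matrix n m} → M ≐ M′ → BinaryRankExactly s d M → BinaryRankExactly s d M′
exactly-resp s d M≐ (c , min) = cover-cong M≐ c , λ r c′ → min r (cover-cong (≐-sym M≐) c′)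

atMost-resp : ∀ s d {n m} {M M′ : Matrix n m} → M ≐ M′ → BinaryRankAtMost s d M → BinaryRankAtMost s d M′
atMost-resp s d M≐ = map id (map (exactly-resp s _ M≐) id)

differ : ∀ {n m} → Matrix n m → Matrix n m → Fin n → Fin m → ℕ
differ M M′ i j = bit (M i j xor M′ i j)

∣tabulate∣ : ∀ {n} (f : Fin n → Bool) → ∣ tabulate f ∣ ≡ Vec.sum (tabulate (bit ∘ f))
∣tabulate∣ {zero}  f = refl
∣tabulate∣ {suc n} f with f zero
... | true  = cong suc (∣tabulate∣ (f ∘ suc))
... | false = ∣tabulate∣ (f ∘ suc)

distance≡∑ : ∀ {n m} (M M′ : Matrix n m) →
             distance M M′ ≡ ∑ (allFin n) λ i → ∑ (allFin m) λ j → differ M M′ i j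
distance≡∑ {n} {m} M M′ = trans
  (cong Vec.sum (Vec.tabulate-cong λ i → trans (∣tabulate∣ {m} (λ j → M i j xor M′ i j)) (sym (∑-allFin (differ M M′ i)))))
  (sym (∑-allFin {n} λ i → ∑ (allFin m) (differ M M′ i)))

distance-triangle : ∀ {n m} (M M′ M″ : Matrix n m) → distance M M″ ≤ distance M M′ + distance M′ M″
distance-triangle {n} {m} M M′ M″ = begin
  distance M M″
    ≡⟨ distance≡∑ M M″ ⟩
  ∑ (allFin n) (λ i → ∑ (allFin m) (differ M M″ i))
    ≤⟨ ∑-mono (allFin n) (λ i → ∑-mono (allFin m) λ j → xor-triangle (M i j) (M′ i j) (M″ i j)) ⟩
  ∑ (allFin n) (λ i → ∑ (allFin m) (λ j → differ M M′ i j + differ M′ M″ i j))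
    ≡⟨ ∑-cong (allFin n) (λ i → ∑-+ (allFin m) (differ M M′ i) (differ M′ M″ i)) ⟩
  ∑ (allFin n) (λ i → ∑ (allFin m) (differ M M′ i) + ∑ (allFin m) (differ M′ M″ i))
    ≡⟨ ∑-+ (allFin n) _ _ ⟩
  ∑ (allFin n) (λ i → ∑ (allFin m) (differ M M′ i)) + ∑ (allFin n) (λ i → ∑ (allFin m) (differ M′ M″ i))
    ≡⟨ cong₂ _+_ (distance≡∑ M M′) (distance≡∑ M′ M″) ⟨
  distance M M′ + distance M′ M″ ∎
  where
  open ≤-Reasoning
  xor-triangle : ∀ x y z → bit (x xor z) ≤ bit (x xor y) + bit (y xor z)
  xor-triangle true  true  z     = ≤-refl
  xor-triangle false false z     = ≤-refl
  xor-triangle true  false true  = z≤n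
  xor-triangle true  false false = ≤-refl
  xor-triangle false true  true  = ≤-refl
  xor-triangle false true  false = z≤n

distance-≐ : ∀ {n m} {M M′ : Matrix n m} → M ≐ M′ → distance M M′ ≡ 0
distance-≐ {n} {m} {M} {M′} M≐ = begin
  distance M M′                                             ≡⟨ distance≡∑ M M′ ⟩
  ∑ (allFin n) (λ i → ∑ (allFin m) (differ M M′ i))         ≡⟨ ∑-cong (allFin n) (λ i → ∑-cong (allFin m) λ j →
                                                                cong bit (trans (cong (M i j xor_) (sym (M≐ i j))) (Bool.xor-same (M i j)))) ⟩
  ∑ (allFin n) (λ i → ∑ (allFin m) (λ _ → 0))               ≡⟨ ∑-cong (allFin n) (λ i → ∑-zero (allFin m)) ⟩
  ∑ (allFin n) (λ i → 0)                                    ≡⟨ ∑-zero (allFin n) ⟩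
  0                                                         ∎
  where open ≡-Reasoning

∑-<≤ : ∀ n d → ∑ (allFin n) (λ i → #[ toℕ i <? d ]) ≤ d
∑-<≤ zero    d       = z≤n
∑-<≤ (suc n) zero    = ≤-reflexive (∑-zero (allFin (suc n)))
∑-<≤ (suc n) (suc d) = ≤-trans (≤-reflexive (∑-allFin-suc {n} (λ i → #[ toℕ i <? suc d ]))) (s≤s (∑-<≤ n d))

-- The diagonal is a fooling set: a rectangle containing `(i , i)` and `(j , j)` also contains
-- `(i , j)`, which is 1 only if `i` equals `j`.
identity-rank : ∀ {s d r} {E : Matrix d d} → (∀ i → E i i ≡ true) → (∀ i j → E i j ≡ true → i ≡ j) →
                HasCover s E r → d ≤ r
identity-rank {d = d} {r} {E} diag off (I , J , cover) = Fin.injective⇒≤ {f = k} λ {i} {j} eq →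
  off i j (cover-one cover (k i) i j (proj₁ (k∈ i)) (subst (λ k → lookup (J k) j ≡ true) (sym eq) (proj₂ (k∈ j))))
  where
  k : Fin d → Fin r
  k i = proj₁ (one⇒rectangle cover (diag i))
  k∈ : ∀ i → lookup (I (k i)) i ≡ true × lookup (J (k i)) i ≡ true
  k∈ i = ∧-true (trans (sym (Vec.lookup∘tabulate _ (k i))) (proj₂ (one⇒rectangle cover (diag i))))

-- Write a d × d identity into the corner of M row by row.  Each step raises the rank by at
-- most one and the last rank is at least d, so that rank d is attained on the way.
exactly-nearby : ∀ {s d n m} (M : Matrix n m) → 1 ≤ s → 1 ≤ d → d ≤ n → d ≤ m → HasCover s M d →
                 ∃ λ M′ → BinaryRankExactly s d M′ × distance M M′ ≤ d * d
exactly-nearby {s} {suc d} {n} {m} M 1≤s _ d≤n d≤m cover = walk (suc d) ≤-refl last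
  where
  -- Only the first `suc d` rows of `N` enter the path below.
  N : Matrix n m
  N i j = if does (toℕ j <? suc d) then does (toℕ i ≟ toℕ j) else M i j
  N-in : ∀ i j → toℕ j < suc d → N i j ≡ does (toℕ i ≟ toℕ j)
  N-in i j j<d = cong (if_then does (toℕ i ≟ toℕ j) else M i j) (dec-true (toℕ j <? suc d) j<d)
  N-out : ∀ i j → toℕ j ≮ suc d → N i j ≡ M i j
  N-out i j j≮d = cong (if_then does (toℕ i ≟ toℕ j) else M i j) (dec-false (toℕ j <? suc d) j≮d)
  H : ℕ → Matrix n m
  H = hybrid M N
  E : Matrix (suc d) (suc d)
  E i j = H (suc d) (inject≤ i d≤n) (inject≤ j d≤m)
  E≡ : ∀ i j → E i j ≡ does (toℕ i ≟ toℕ j)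
  E≡ i j = begin
    E i j                                                ≡⟨ hybrid-above M N _ _ (subst (_< suc d) (sym (Fin.toℕ-inject≤ i d≤n)) (Fin.toℕ<n i)) ⟩
    N (inject≤ i d≤n) (inject≤ j d≤m)                    ≡⟨ N-in _ _ (subst (_< suc d) (sym (Fin.toℕ-inject≤ j d≤m)) (Fin.toℕ<n j)) ⟩
    does (toℕ (inject≤ i d≤n) ≟ toℕ (inject≤ j d≤m))     ≡⟨ cong₂ (λ x y → does (x ≟ y)) (Fin.toℕ-inject≤ i d≤n) (Fin.toℕ-inject≤ j d≤m) ⟩
    does (toℕ i ≟ toℕ j)                                 ∎
    where open ≡-Reasoning
  off : ∀ i j → E i j ≡ true → i ≡ j
  off i j eq = Fin.toℕ-injective (does-sound (toℕ i ≟ toℕ j) (trans (sym (E≡ i j)) eq))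
  -- The corner is now an identity of order `suc d`, too large for `d` rectangles.
  last : ¬ HasCover s (H (suc d)) d
  last c = 1+n≰n (identity-rank {E = E} (λ i → trans (E≡ i i) (dec-true (toℕ i ≟ toℕ i) refl)) off
    (cover-pull (λ i → just (inject≤ i d≤n)) (λ j → just (inject≤ j d≤m)) {M = H (suc d)} c))
  near : ∀ t → t ≤ suc d → distance M (H t) ≤ suc d * suc d
  near t t≤d = begin
    distance M (H t)
      ≡⟨ distance≡∑ M (H t) ⟩
    ∑ (allFin n) (λ i → ∑ (allFin m) (differ M (H t) i))
      ≤⟨ ∑-mono (allFin n) (λ i → ∑-mono (allFin m) (pointwise i)) ⟩
    ∑ (allFin n) (λ i → ∑ (allFin m) (λ j → χ i * χ j))
      ≡⟨ ∑-cong (allFin n) (λ i → trans (∑-* (χ i) (allFin m) χ) (*-comm (χ i) _)) ⟩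
    ∑ (allFin n) (λ i → ∑ (allFin m) χ * χ i)
      ≡⟨ ∑-* (∑ (allFin m) χ) (allFin n) χ ⟩
    ∑ (allFin m) χ * ∑ (allFin n) χ
      ≤⟨ *-mono-≤ (∑-<≤ m (suc d)) (∑-<≤ n (suc d)) ⟩
    suc d * suc d ∎
    where
    open ≤-Reasoning
    χ : ∀ {k} → Fin k → ℕ
    χ i = #[ toℕ i <? suc d ]
    same : ∀ {i j} → M i j ≡ H t i j → differ M (H t) i j ≤ χ i * χ j
    same {i} {j} eq = ≤-trans (≤-reflexive (cong bit (trans (cong (M i j xor_) (sym eq)) (Bool.xor-same (M i j))))) z≤n
    pointwise : ∀ i j → differ M (H t) i j ≤ χ i * χ j
    pointwise i j with toℕ i <? t | toℕ j <? suc d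
    ... | no i≮t  | _       = same {i} {j} (sym (hybrid-below M N i j (≮⇒≥ i≮t)))
    ... | yes i<t | no j≮d  = same {i} {j} (sym (trans (hybrid-above M N i j i<t) (N-out i j j≮d)))
    ... | yes i<t | yes j<d = ≤-trans (bit≤1 _) (*-mono-≤ (1≤# (toℕ i <? suc d) (≤-trans i<t t≤d)) (1≤# (toℕ j <? suc d) j<d))
  Result : Set
  Result = ∃ λ M′ → BinaryRankExactly s (suc d) M′ × distance M M′ ≤ suc d * suc d
  -- Go back along the path to the first `H t` with a cover by `d` rectangles; its successor then
  -- needs exactly `suc d`. If none is met, the walk ends at `H 0`, which is `M` and has a cover by
  -- `suc d`.
  walk : ∀ t → t ≤ suc d → ¬ HasCover s (H t) d → Result
  walk zero    _   ¬c = H 0 , cover⇒exactly {M = H 0} cover ¬c , near 0 z≤n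
  walk (suc t) t<d ¬c with hasCover? s (H t) d
  ... | yes c  = H (suc t) , cover⇒exactly {M = H (suc t)} (hybrid-suc M N 1≤s (≤-trans t<d d≤n) c) ¬c , near (suc t) t<d
  ... | no ¬c′ = walk t (<⇒≤ t<d) ¬c′

-- Covers by single rows and by single columns always exist. Hence one matrix of rank `d` shows that
-- the identity corner of `exactly-nearby` fits.
exactly⇒≤ : ∀ {s d n m} {M : Matrix n m} → 1 ≤ s → BinaryRankExactly s d M → d ≤ n × d ≤ m
exactly⇒≤ {M = M} 1≤s (_ , minimal) = minimal _ (cover-by-rows M 1≤s) , minimal _ (cover-by-columns M 1≤s)

-- Prediction from a sample

sub : ∀ {n m a b} → Matrix n m → Vec (Fin n) a → Vec (Fin m) b → Matrix a b
sub M X Y i j = M (lookup X i) (lookup Y j)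

witness : ∀ {a} {P : Fin a → Set} → Dec (∃ P) → Maybe (Fin a)
witness (yes (i , _)) = just i
witness (no _)        = nothing

witness-just : ∀ {a} {P : Fin a → Set} (P? : Dec (∃ P)) → ∃ P → ∃ λ i → witness P? ≡ just i × P i
witness-just (yes (i , p)) _ = i , refl , p
witness-just (no ∄)        p = ⊥-elim (∄ p)

module _ {n m} (M : Matrix n m) {a b} (X : Vec (Fin n) a) (Y : Vec (Fin m) b) where

  SameRow : Fin n → Fin a → Set
  SameRow r i = ∀ j → M r (lookup Y j) ≡ M (lookup X i) (lookup Y j)

  sameRow? : ∀ r → Dec (∃ (SameRow r))
  sameRow? r = Fin.any? λ i → Fin.all? λ j → M r (lookup Y j) Bool.≟ M (lookup X i) (lookup Y j)

module _ {n m} (M : Matrix n m) {a b} (X : Vec (Fin n) a) (Y : Vec (Fin m) b) where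

  -- As a pullback of the sampled submatrix the prediction inherits its cover. A row or column that
  -- matches nothing in the sample is predicted as zero.
  predict : Matrix n m
  predict = pull (witness ∘ sameRow? M X Y) (witness ∘ sameRow? (flip M) Y X) (sub M X Y)

  predict-cover : ∀ {s d} → HasCover s (sub M X Y) d → HasCover s predict d
  predict-cover = cover-pull (witness ∘ sameRow? M X Y) (witness ∘ sameRow? (flip M) Y X)

  -- The prediction uses the matches `i` and `j` found by its own search, which may differ from the
  -- given ones.
  predict-value : ∀ {r c} → ∃ (SameRow M X Y r) → ∃ (SameRow (flip M) Y X c) →
                  ∃₂ λ i j → predict r c ≡ M (lookup X i) (lookup Y j) × SameRow M X Y r i × SameRow (flip M) Y X c j
  predict-value {r} {c} ∃i ∃j with witness-just (sameRow? M X Y r) ∃i | witness-just (sameRow? (flip M) Y X c) ∃j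
  ... | i , eq , same | j , eq′ , same′ = i , j , value , same , same′
    where
    value : predict r c ≡ M (lookup X i) (lookup Y j)
    value rewrite eq | eq′ = refl

length-samples : ∀ {n m} a b → length (vectors (allFin n) a) * length (vectors (allFin m) b) ≡ n ^ a * m ^ b
length-samples {n} {m} a b = cong₂ _*_
  (trans (length-vectors (allFin n) a) (cong (_^ a) (length-allFin n)))
  (trans (length-vectors (allFin m) b) (cong (_^ b) (length-allFin m)))

module _ {n m} (M : Matrix n m) (s d t u : ℕ) where

  Event : ∀ {a b} → Vec (Fin n) a → Vec (Fin m) b → Set
  Event X Y = HasCover s (sub M X Y) d × rows (sub M X Y) ≤ t × cols (sub M X Y) ≤ u

  abstract
    event? : ∀ {a b} (X : Vec (Fin n) a) (Y : Vec (Fin m) b) → Dec (Event X Y)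
    event? X Y = hasCover? s (sub M X Y) d ×-dec (rows (sub M X Y) ≤? t) ×-dec (cols (sub M X Y) ≤? u)

  error : ∀ {a b} → Fin n → Vec (Fin n) a → Fin m → Vec (Fin m) b → ℕ
  error x X y Y = #[ event? X Y ] * differ M (predict M X Y) x y

  module _ {a b} (X : Vec (Fin n) (suc a)) (Y : Vec (Fin m) (suc b)) where

    private
      X∖ : Fin (suc a) → Vec (Fin n) a
      X∖ = removeAt X
      Y∖ : Fin (suc b) → Vec (Fin m) b
      Y∖ = removeAt Y

      colOn : Fin (suc a) → Fin (suc b) → Vec Bool a
      colOn k l = tabulate λ i → M (lookup (X∖ k) i) (lookup Y l)

      rowOn : Fin (suc a) → Vec Bool (suc b)
      rowOn k = tabulate λ j → M (lookup X k) (lookup Y j)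

      -- Columns are compared on the rows left after deleting `k`, but rows, in `NewRow`, on all
      -- columns. So `NewRow` is free of `l`, and the new rows can be counted once for all `l`.
      NewCol : Fin (suc a) → Fin (suc b) → Set
      NewCol k l = Alone (colOn k) l × cols (sub M (X∖ k) (Y∖ l)) ≤ u

      newCol? : ∀ k l → Dec (NewCol k l)
      newCol? k l = alone? (colOn k) l ×-dec (cols (sub M (X∖ k) (Y∖ l)) ≤? u)

      NewRow : Fin (suc a) → Set
      NewRow k = Alone rowOn k × rows (sub M (X∖ k) Y) ≤ t

      newRow? : ∀ k → Dec (NewRow k)
      newRow? k = alone? rowOn k ×-dec (rows (sub M (X∖ k) Y) ≤? t)

      -- If column l repeats a column of Y∖ l on X∖ k, then adding it does not split the rows of
      -- X∖ k; a second row agreeing with k on Y then forces the prediction to be right.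
      error⇒new : ∀ k l → Event (X∖ k) (Y∖ l) →
                  predict M (X∖ k) (Y∖ l) (lookup X k) (lookup Y l) ≢ M (lookup X k) (lookup Y l) →
                  NewCol k l ⊎ NewRow k
      error⇒new k l (_ , rows≤ , cols≤) wrong with alone? (colOn k) l
      ... | yes alone = inj₁ (alone , cols≤)
      ... | no ¬alone with Fin.any? (λ l′ → Vec.≡-dec Bool._≟_ (colOn k l) (colOn k l′) ×-dec ¬? (l Fin.≟ l′))
      ...   | no ∄l′ = ⊥-elim (¬alone λ l′ eq → case l Fin.≟ l′ of λ
                { (yes l≡l′) → l≡l′ ; (no l≢l′) → ⊥-elim (∄l′ (l′ , eq , l≢l′)) })
      ...   | yes (l′ , eq , l≢l′) = inj₂ (rowAlone , ≤-trans noSplit rows≤)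
        where
        same-col : SameRow (flip M) (Y∖ l) (X∖ k) (lookup Y l) (punchOut l≢l′)
        same-col i = trans (tabulate-injective eq i)
          (cong (M (lookup (X∖ k) i)) (sym (Vec.removeAt-punchOut Y l≢l′)))
        noSplit : rows (sub M (X∖ k) Y) ≤ rows (sub M (X∖ k) (Y∖ l))
        noSplit = distinct-mono _ _ id λ i i′ e → Vec.tabulate-cong λ j → agree i i′ (tabulate-injective e) j
          where
          agree : ∀ i i′ → (∀ j → sub M (X∖ k) (Y∖ l) i j ≡ sub M (X∖ k) (Y∖ l) i′ j) →
                  ∀ j → sub M (X∖ k) Y i j ≡ sub M (X∖ k) Y i′ j
          agree i i′ e j with l Fin.≟ j
          ... | yes refl = trans (same-col i) (trans (e (punchOut l≢l′)) (sym (same-col i′)))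
          ... | no l≢j   = trans (cong (M (lookup (X∖ k) i)) (sym (Vec.removeAt-punchOut Y l≢j)))
                          (trans (e (punchOut l≢j)) (cong (M (lookup (X∖ k) i′)) (Vec.removeAt-punchOut Y l≢j)))
        rowAlone : Alone rowOn k
        rowAlone k′ e with k Fin.≟ k′
        ... | yes k≡k′ = k≡k′
        ... | no k≢k′  = ⊥-elim (wrong right)
          where
          i₀ = punchOut k≢k′
          Xi₀ : lookup (X∖ k) i₀ ≡ lookup X k′
          Xi₀ = Vec.removeAt-punchOut X k≢k′
          agree : ∀ j → M (lookup X k) (lookup Y j) ≡ M (lookup (X∖ k) i₀) (lookup Y j)
          agree j = trans (tabulate-injective {f = λ j → M (lookup X k) (lookup Y j)} {g = λ j → M (lookup X k′) (lookup Y j)} e j) (cong (λ x → M x (lookup Y j)) (sym Xi₀))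
          agree∖ : SameRow M (X∖ k) (Y∖ l) (lookup X k) i₀
          agree∖ j = lookup-removeAt Y l (λ y → M (lookup X k) y ≡ M (lookup (X∖ k) i₀) y) agree j
            where
            lookup-removeAt : ∀ {A : Set} {n} (V : Vec A (suc n)) k (P : A → Set) →
                              (∀ j → P (lookup V j)) → ∀ j → P (lookup (removeAt V k) j)
            lookup-removeAt (x ∷ V)         zero    P p j       = p (suc j)
            lookup-removeAt (x ∷ V@(_ ∷ _)) (suc k) P p zero    = p zero
            lookup-removeAt (x ∷ V@(_ ∷ _)) (suc k) P p (suc j) = lookup-removeAt V k P (p ∘ suc) j
          right : predict M (X∖ k) (Y∖ l) (lookup X k) (lookup Y l) ≡ M (lookup X k) (lookup Y l)
          right with predict-value M (X∖ k) (Y∖ l) (i₀ , agree∖) (punchOut l≢l′ , same-col)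
          -- On column `j`, pass from the matched row `i` to row `k` and on to `i₀`; in row `i₀`,
          -- which belongs to the sample, exchange column `j` for `l`; then return to row `k`.
          ... | i , j , value , same , same′ = begin
            predict M (X∖ k) (Y∖ l) (lookup X k) (lookup Y l) ≡⟨ value ⟩
            M (lookup (X∖ k) i) (lookup (Y∖ l) j)             ≡⟨ same j ⟨
            M (lookup X k) (lookup (Y∖ l) j)                  ≡⟨ agree∖ j ⟩
            M (lookup (X∖ k) i₀) (lookup (Y∖ l) j)            ≡⟨ same′ i₀ ⟨
            M (lookup (X∖ k) i₀) (lookup Y l)                 ≡⟨ agree l ⟨
            M (lookup X k) (lookup Y l)                       ∎
            where open ≡-Reasoning

      error≤ : ∀ k l → error (lookup X k) (X∖ k) (lookup Y l) (Y∖ l) ≤ #[ newCol? k l ] + #[ newRow? k ]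
      error≤ k l = #*≤ (event? (X∖ k) (Y∖ l)) λ e →
        bound (M (lookup X k) (lookup Y l)) (predict M (X∖ k) (Y∖ l) (lookup X k) (lookup Y l)) (error⇒new k l e)
        where
        bound : ∀ x y → (y ≢ x → NewCol k l ⊎ NewRow k) → bit (x xor y) ≤ #[ newCol? k l ] + #[ newRow? k ]
        bound x y h with y Bool.≟ x
        ... | yes refl = ≤-trans (≤-reflexive (cong bit (Bool.xor-same x))) z≤n
        ... | no y≢x   = ≤-trans (bit≤1 (x xor y)) ([ (λ c → ≤-trans (1≤# (newCol? k l) c) (m≤m+n _ _))
                                                   , (λ r → ≤-trans (1≤# (newRow? k) r) (m≤n+m _ _)) ]′ (h y≢x))

    -- By `leave-one-out`, for each `k` at most `suc u` of the `l` give a new column, and at most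
    -- `suc t` of the `k` give a new row.
    ∑-errors : ∑ (allFin (suc a)) (λ k → ∑ (allFin (suc b)) λ l → error (lookup X k) (removeAt X k) (lookup Y l) (removeAt Y l))
               ≤ suc a * suc u + suc b * suc t
    ∑-errors = begin
      ∑ K (λ k → ∑ L λ l → error (lookup X k) (X∖ k) (lookup Y l) (Y∖ l))
        ≤⟨ ∑-mono K (λ k → ∑-mono L (error≤ k)) ⟩
      ∑ K (λ k → ∑ L λ l → col k l + row k)
        ≡⟨ ∑-cong K (λ k → ∑-+ L (col k) (λ _ → row k)) ⟩
      ∑ K (λ k → ∑ L (col k) + ∑ L (λ _ → row k))
        ≡⟨ ∑-+ K (λ k → ∑ L (col k)) (λ k → ∑ L (λ _ → row k)) ⟩
      ∑ K (λ k → ∑ L (col k)) + ∑ K (λ k → ∑ L (λ _ → row k))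
        ≡⟨ cong (∑ K (λ k → ∑ L (col k)) +_) (∑-swap K L (λ k _ → row k)) ⟩
      ∑ K (λ k → ∑ L (col k)) + ∑ L (λ _ → ∑ K row)
        ≤⟨ +-mono-≤ (∑-mono K new-cols) (∑-mono L λ _ → new-rows) ⟩
      ∑ K (λ _ → suc u) + ∑ L (λ _ → suc t)
        ≡⟨ cong₂ _+_ (∑-allFin-const (suc a) {suc u}) (∑-allFin-const (suc b) {suc t}) ⟩
      suc a * suc u + suc b * suc t ∎
      where
      open ≤-Reasoning
      K = allFin (suc a)
      L = allFin (suc b)
      col : Fin (suc a) → Fin (suc b) → ℕ
      col k l = #[ newCol? k l ]
      row : Fin (suc a) → ℕ
      row k = #[ newRow? k ]
      new-cols : ∀ k → ∑ L (col k) ≤ suc u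
      new-cols k = leave-one-out (colOn k) (λ l j → tabulate λ i → M (lookup (X∖ k) i) (lookup (Y∖ l) j))
        (λ l → cols (sub M (X∖ k) (Y∖ l)) ≤? u)
        (λ l l≢ → Vec.tabulate-cong λ i → cong (M (lookup (X∖ k) i)) (Vec.removeAt-punchOut Y l≢))
        (λ l → id)
      new-rows : ∑ K row ≤ suc t
      new-rows = leave-one-out rowOn (λ k i → tabulate λ j → M (lookup (X∖ k) i) (lookup Y j))
        (λ k → rows (sub M (X∖ k) Y) ≤? t)
        (λ k k≢ → Vec.tabulate-cong λ j → cong (λ x → M x (lookup Y j)) (Vec.removeAt-punchOut X k≢))
        (λ k → id)

  balanced : ∀ {a b D} → D * suc t ≤ suc a → D * suc u ≤ suc b →
              D * (suc a * suc u + suc b * suc t) ≤ 2 * (suc a * suc b)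
  balanced {a} {b} {D} Dt Du = begin
    D * (suc a * suc u + suc b * suc t)           ≡⟨ expand D (suc a) (suc b) (suc t) (suc u) ⟩
    suc a * (D * suc u) + suc b * (D * suc t)     ≤⟨ +-mono-≤ (*-monoʳ-≤ (suc a) Du) (*-monoʳ-≤ (suc b) Dt) ⟩
    suc a * suc b + suc b * suc a                 ≡⟨ collect (suc a) (suc b) ⟩
    2 * (suc a * suc b)                           ∎
    where
    open ≤-Reasoning
    expand : ∀ D a b t u → D * (a * u + b * t) ≡ a * (D * u) + b * (D * t)
    expand = solve-∀
    collect : ∀ a b → a * b + b * a ≡ 2 * (a * b)
    collect = solve-∀

  module _ {a b : ℕ} where

    private
      V = vectors (allFin n) a
      W = vectors (allFin m) b

    totalError : ℕ
    totalError = ∑ (allFin n) λ x → ∑ V λ X → ∑ (allFin m) λ y → ∑ W λ Y → error x X y Y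

    -- Any entry of a sample of size a + 1 may play the part of the extra one.
    totalError-exchange : ∀ (k : Fin (suc a)) (l : Fin (suc b)) →
      ∑ (vectors (allFin n) (suc a)) (λ X → ∑ (vectors (allFin m) (suc b)) λ Y →
        error (lookup X k) (removeAt X k) (lookup Y l) (removeAt Y l)) ≡ totalError
    totalError-exchange k l = trans
      (∑-removeAt (allFin n) k λ x X → ∑ (vectors (allFin m) (suc b)) λ Y → error x X (lookup Y l) (removeAt Y l))
      (∑-cong (allFin n) λ x → ∑-cong V λ X → ∑-removeAt (allFin m) l (error x X))

    -- Double counting: sum the exchange identity over all `k` and `l`, then interchange the sums so
    -- that `∑-errors` applies to each sample of lengths `suc a` and `suc b`.
    totalError≤ : suc a * (suc b * totalError) ≤ n ^ suc a * m ^ suc b * (suc a * suc u + suc b * suc t)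
    totalError≤ = begin
      suc a * (suc b * totalError)
        ≡⟨ cong (suc a *_) (∑-allFin-const (suc b)) ⟨
      suc a * ∑ L (λ _ → totalError)
        ≡⟨ ∑-allFin-const (suc a) ⟨
      ∑ K (λ _ → ∑ L λ _ → totalError)
        ≡⟨ ∑-cong K (λ k → ∑-cong L (totalError-exchange k)) ⟨
      ∑ K (λ k → ∑ L λ l → ∑ V⁺ λ X → ∑ W⁺ λ Y → e k l X Y)
        ≡⟨ ∑-cong K (λ k → ∑-swap L V⁺ λ l X → ∑ W⁺ λ Y → e k l X Y) ⟩
      ∑ K (λ k → ∑ V⁺ λ X → ∑ L λ l → ∑ W⁺ λ Y → e k l X Y)
        ≡⟨ ∑-swap K V⁺ (λ k X → ∑ L λ l → ∑ W⁺ λ Y → e k l X Y) ⟩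
      ∑ V⁺ (λ X → ∑ K λ k → ∑ L λ l → ∑ W⁺ λ Y → e k l X Y)
        ≡⟨ ∑-cong V⁺ (λ X → ∑-cong K λ k → ∑-swap L W⁺ λ l Y → e k l X Y) ⟩
      ∑ V⁺ (λ X → ∑ K λ k → ∑ W⁺ λ Y → ∑ L λ l → e k l X Y)
        ≡⟨ ∑-cong V⁺ (λ X → ∑-swap K W⁺ λ k Y → ∑ L λ l → e k l X Y) ⟩
      ∑ V⁺ (λ X → ∑ W⁺ λ Y → ∑ K λ k → ∑ L λ l → e k l X Y)
        ≤⟨ ∑-mono V⁺ (λ X → ∑-mono W⁺ λ Y → ∑-errors X Y) ⟩
      ∑ V⁺ (λ _ → ∑ W⁺ λ _ → G)
        ≡⟨ trans (∑-const V⁺ _) (cong (length V⁺ *_) (∑-const W⁺ G)) ⟩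
      length V⁺ * (length W⁺ * G)
        ≡⟨ trans (sym (*-assoc (length V⁺) (length W⁺) G)) (cong (_* G) (length-samples {n} {m} (suc a) (suc b))) ⟩
      n ^ suc a * m ^ suc b * G ∎
      where
      open ≤-Reasoning
      K = allFin (suc a)
      L = allFin (suc b)
      V⁺ = vectors (allFin n) (suc a)
      W⁺ = vectors (allFin m) (suc b)
      G = suc a * suc u + suc b * suc t
      e : Fin (suc a) → Fin (suc b) → Vec (Fin n) (suc a) → Vec (Fin m) (suc b) → ℕ
      e k l X Y = error (lookup X k) (removeAt X k) (lookup Y l) (removeAt Y l)

    occurrences : ℕ
    occurrences = ∑ V λ X → ∑ W λ Y → #[ event? X Y ]

    -- For a sample in the event the prediction has a cover by `d` rectangles, so by hypothesis it
    -- is wrong on at least a share `1 / Q` of the entries.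
    occurrences≤totalError : ∀ {Q} → (∀ M′ → HasCover s M′ d → n * m ≤ Q * distance M M′) →
                             n * m * occurrences ≤ Q * totalError
    occurrences≤totalError {Q} far = begin
      n * m * occurrences
        ≡⟨ ∑-* (n * m) V _ ⟨
      ∑ V (λ X → n * m * ∑ W (λ Y → #[ event? X Y ]))
        ≡⟨ ∑-cong V (λ X → ∑-* (n * m) W (λ Y → #[ event? X Y ])) ⟨
      ∑ V (λ X → ∑ W λ Y → n * m * #[ event? X Y ])
        ≤⟨ ∑-mono V (λ X → ∑-mono W λ Y → local X Y) ⟩
      ∑ V (λ X → ∑ W λ Y → Q * ∑ (allFin n) λ x → ∑ (allFin m) λ y → error x X y Y)
        ≡⟨ trans (∑-cong V (λ X → ∑-* Q W _)) (∑-* Q V _) ⟩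
      Q * ∑ V (λ X → ∑ W λ Y → ∑ (allFin n) λ x → ∑ (allFin m) λ y → error x X y Y)
        ≡⟨ cong (Q *_) (∑-cong V λ X → trans (∑-swap W (allFin n) λ Y x → ∑ (allFin m) λ y → error x X y Y)
             (∑-cong (allFin n) λ x → ∑-swap W (allFin m) λ Y y → error x X y Y)) ⟩
      Q * ∑ V (λ X → ∑ (allFin n) λ x → ∑ (allFin m) λ y → ∑ W λ Y → error x X y Y)
        ≡⟨ cong (Q *_) (∑-swap V (allFin n) λ X x → ∑ (allFin m) λ y → ∑ W λ Y → error x X y Y) ⟩
      Q * totalError ∎
      where
      open ≤-Reasoning
      local : ∀ X Y → n * m * #[ event? X Y ] ≤ Q * ∑ (allFin n) λ x → ∑ (allFin m) λ y → error x X y Y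
      local X Y = begin
        n * m * #[ event? X Y ]
          ≡⟨ *-comm (n * m) _ ⟩
        #[ event? X Y ] * (n * m)
          ≤⟨ *-if (event? X Y) (λ ev → far (predict M X Y) (predict-cover M X Y (proj₁ ev))) ⟩
        #[ event? X Y ] * (Q * distance M (predict M X Y))
          ≡⟨ rotate #[ event? X Y ] Q (distance M (predict M X Y)) ⟩
        Q * (#[ event? X Y ] * distance M (predict M X Y))
          ≡⟨ cong (λ δ → Q * (#[ event? X Y ] * δ)) (distance≡∑ M (predict M X Y)) ⟩
        Q * (#[ event? X Y ] * ∑ (allFin n) λ x → ∑ (allFin m) (differ M (predict M X Y) x))
          ≡⟨ cong (Q *_) (trans (∑-cong (allFin n) λ x → ∑-* #[ event? X Y ] (allFin m) _) (∑-* #[ event? X Y ] (allFin n) _)) ⟨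
        Q * ∑ (allFin n) (λ x → ∑ (allFin m) λ y → error x X y Y) ∎
        where
        *-if : ∀ {P : Set} (P? : Dec P) {x y} → (P → x ≤ y) → #[ P? ] * x ≤ #[ P? ] * y
        *-if (yes p) x≤y = *-monoʳ-≤ 1 (x≤y p)
        *-if (no _)  _   = z≤n
        rotate : ∀ x y z → x * (y * z) ≡ y * (x * z)
        rotate = solve-∀

    -- The event has probability at most `2 * Q / D`: within it the share of errors is at least
    -- `1 / Q`, whereas the mean share is at most `2 / D` by `totalError≤` and `balanced`.
    event-rare : ∀ .{{_ : NonZero n}} .{{_ : NonZero m}} {Q D} → D * suc t ≤ suc a → D * suc u ≤ suc b →
                 (∀ M′ → HasCover s M′ d → n * m ≤ Q * distance M M′) →
                 D * occurrences ≤ 2 * Q * (n ^ a * m ^ b)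
    event-rare {Q} {D} Dt Du far = *-cancelˡ-≤ (suc a * suc b * (n * m)) {{positive}} (begin
      suc a * suc b * (n * m) * (D * occurrences)
        ≡⟨ shuffle₁ (suc a) (suc b) (n * m) D occurrences ⟩
      suc a * suc b * D * (n * m * occurrences)
        ≤⟨ *-monoʳ-≤ (suc a * suc b * D) (occurrences≤totalError {Q} far) ⟩
      suc a * suc b * D * (Q * totalError)
        ≡⟨ shuffle₂ (suc a) (suc b) D Q totalError ⟩
      Q * D * (suc a * (suc b * totalError))
        ≤⟨ *-monoʳ-≤ (Q * D) totalError≤ ⟩
      Q * D * (n ^ suc a * m ^ suc b * G)
        ≡⟨ shuffle₃ Q D (n ^ suc a * m ^ suc b) G ⟩
      Q * (n ^ suc a * m ^ suc b) * (D * G)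
        ≤⟨ *-monoʳ-≤ (Q * (n ^ suc a * m ^ suc b)) (balanced {a} {b} {D} Dt Du) ⟩
      Q * (n ^ suc a * m ^ suc b) * (2 * (suc a * suc b))
        ≡⟨ shuffle₄ Q n (n ^ a) m (m ^ b) (suc a) (suc b) ⟩
      suc a * suc b * (n * m) * (2 * Q * (n ^ a * m ^ b)) ∎)
      where
      open ≤-Reasoning
      G = suc a * suc u + suc b * suc t
      positive : NonZero (suc a * suc b * (n * m))
      positive = m*n≢0 (suc a * suc b) (n * m) {{_}} {{m*n≢0 n m}}
      shuffle₁ : ∀ a b c d e → a * b * c * (d * e) ≡ a * b * d * (c * e)
      shuffle₁ = solve-∀
      shuffle₂ : ∀ a b c d e → a * b * c * (d * e) ≡ d * c * (a * (b * e))
      shuffle₂ = solve-∀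
      shuffle₃ : ∀ a b c d → a * b * (c * d) ≡ a * c * (b * d)
      shuffle₃ = solve-∀
      shuffle₄ : ∀ q n x m y a b → q * (n * x * (m * y)) * (2 * (a * b)) ≡ a * b * (n * m) * (2 * q * (x * y))
      shuffle₄ = solve-∀

-- Prefix grids

lookup-truncate² : ∀ {A : Set} {a b c} (a≤b : a ≤ b) (b≤c : b ≤ c) (a≤c : a ≤ c) (V : Vec A c) (i : Fin a) →
                   lookup (truncate a≤c V) i ≡ lookup (truncate b≤c V) (inject≤ i a≤b)
lookup-truncate² a≤b b≤c a≤c V i = begin
  lookup (truncate a≤c V) i                         ≡⟨ cong (λ p → lookup (truncate p V) i) (≤-irrelevant a≤c (≤-trans a≤b b≤c)) ⟩
  lookup (truncate (≤-trans a≤b b≤c) V) i           ≡⟨ cong (λ W → lookup W i) (Vec.truncate-trans a≤b b≤c V) ⟩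
  lookup (truncate a≤b (truncate b≤c V)) i          ≡⟨ Vec.lookup-truncate a≤b (truncate b≤c V) i ⟩
  lookup (truncate b≤c V) (inject≤ i a≤b)           ∎
  where open ≡-Reasoning

module _ {n m a a′ A b b′ B} (M : Matrix n m) {X : Vec (Fin n) A} {Y : Vec (Fin m) B}
         (a≤A : a ≤ A) (a′≤A : a′ ≤ A) (b≤B : b ≤ B) (b′≤B : b′ ≤ B) (a≤a′ : a ≤ a′) (b≤b′ : b ≤ b′) where

  sub-truncate : ∀ i j → sub M (truncate a≤A X) (truncate b≤B Y) i j
                         ≡ sub M (truncate a′≤A X) (truncate b′≤B Y) (inject≤ i a≤a′) (inject≤ j b≤b′)
  sub-truncate i j = cong₂ M (lookup-truncate² a≤a′ a′≤A a≤A X i) (lookup-truncate² b≤b′ b′≤B b≤B Y j)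

  rows-truncate : rows (sub M (truncate a≤A X) (truncate b≤B Y)) ≤ rows (sub M (truncate a′≤A X) (truncate b′≤B Y))
  rows-truncate = rows-mono _ _ (λ i → inject≤ i a≤a′) (λ j → inject≤ j b≤b′) sub-truncate

  cover-truncate : ∀ {s d} → HasCover s (sub M (truncate a′≤A X) (truncate b′≤B Y)) d →
                   HasCover s (sub M (truncate a≤A X) (truncate b≤B Y)) d
  cover-truncate c = cover-cong (λ i j → sym (sub-truncate i j))
    (cover-pull (λ i → just (inject≤ i a≤a′)) (λ j → just (inject≤ j b≤b′)) {M = sub M (truncate a′≤A X) (truncate b′≤B Y)} c)

-- A discrete intermediate value theorem. The predicate takes the proof of `i ≤ e` because prefixes
-- do; `≤-irrelevant` reconciles different proofs.
crossing : ∀ e {P : ∀ i → i ≤ e → Set} → (∀ i i≤e → Dec (P i i≤e)) → P 0 z≤n → ¬ P e ≤-refl →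
           ∃ λ i → Σ[ i<e ∈ i < e ] P i (<⇒≤ i<e) × ¬ P (suc i) i<e
crossing zero    P? p₀ ¬pₑ = ⊥-elim (¬pₑ p₀)
crossing (suc e) {P} P? p₀ ¬pₑ with P? e (n≤1+n e)
... | yes pₑ = e , ≤-refl , subst (P e) (≤-irrelevant _ _) pₑ , ¬pₑ
... | no ¬p with crossing e {λ i i≤e → P i (m≤n⇒m≤1+n i≤e)} (λ i i≤e → P? i (m≤n⇒m≤1+n i≤e)) p₀
                   (¬p ∘ subst (P e) (≤-irrelevant _ _))
...   | i , i<e , p , ¬p′ = i , m≤n⇒m≤1+n i<e , subst (P i) (≤-irrelevant _ _) p , ¬p′ ∘ subst (P (suc i)) (≤-irrelevant _ _)

-- The factor D makes a prefix at least D times as long as the number of distinct rows, 2^(i + 1), or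
-- columns, (d C≤ s) 2^(d - i), that it shows at the crossing step i; the indices of α and β are
-- shifted so that both hold for the grid α (i + 1) × β (i + 1).
module Prefixes (s d D : ℕ) where

  abstract
    -- Abstract, so that the lengths stay neutral and are unfolded elsewhere only through `α≡` and
    -- `β≡`.
    α : ℕ → ℕ
    α i = D * 2 ^ i

    β : ℕ → ℕ
    β i = D * suc ((d C≤ s) * 2 ^ (suc d ∸ i))

    α≡ : ∀ i → α i ≡ D * 2 ^ i
    α≡ i = refl

    β≡ : ∀ i → β i ≡ D * suc ((d C≤ s) * 2 ^ (suc d ∸ i))
    β≡ i = refl

    α-mono : ∀ {i j} → i ≤ j → α i ≤ α j
    α-mono i≤j = *-monoʳ-≤ D (^-monoʳ-≤ 2 i≤j)

    β-anti : ∀ {i j} → i ≤ j → β j ≤ β i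
    β-anti i≤j = *-monoʳ-≤ D (s≤s (*-monoʳ-≤ (d C≤ s) (^-monoʳ-≤ 2 (∸-monoʳ-≤ (suc d) i≤j))))

  -- The predecessor turns "fewer than `2 ^ suc i`" into a non-strict bound, whose successor is
  -- again the power of 2 in `α (suc i)`.
  rowBound : ℕ → ℕ
  rowBound i = pred (2 ^ suc i)

  suc-rowBound : ∀ i → suc (rowBound i) ≡ 2 ^ suc i
  suc-rowBound i = suc-pred (2 ^ suc i) {{m^n≢0 2 (suc i)}}

  colBound : ℕ → ℕ
  colBound i = (d C≤ s) * 2 ^ (d ∸ i)

  rowPrefix : ∀ {A : Set} i → i ≤ suc d → Vec A (α (suc d)) → Vec A (α i)
  rowPrefix i i≤ = truncate (α-mono i≤)

  colPrefix : ∀ {A : Set} i → Vec A (β 0) → Vec A (β i)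
  colPrefix i = truncate (β-anti {0} {i} z≤n)

  module _ {n m : ℕ} where

    -- With rows of step `suc i` and columns of step `i`, the tested grid contains the grids of both
    -- steps, so that what is seen before and after a crossing can be compared in it.
    PassesAt : Matrix n m → Vec (Fin n) (α (suc d)) → Vec (Fin m) (β 0) → ∀ i → i < suc d → Set
    PassesAt M X Y i i<e = HasCover s (sub M (rowPrefix (suc i) i<e X) (colPrefix i Y)) d

    Passes : Matrix n m → Vec (Fin n) (α (suc d)) → Vec (Fin m) (β 0) → Set
    Passes M X Y = ∀ i i<e → PassesAt M X Y i i<e

    EventAt : Matrix n m → Vec (Fin n) (α (suc d)) → Vec (Fin m) (β 0) → ∀ i → i < suc d → Set
    EventAt M X Y i i<e = Event M s d (rowBound i) (colBound i) (rowPrefix (suc i) i<e X) (colPrefix (suc i) Y)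

    passes⇒event : ∀ (M : Matrix n m) X Y → 1 ≤ D → Passes M X Y → ∃ λ i → Σ[ i<e ∈ i < suc d ] EventAt M X Y i i<e
    passes⇒event M X Y 1≤D passes = finish (crossing (suc d) (λ i i≤ → 2 ^ i ≤? R i i≤) many₀ few)
      where
      R : ∀ i → i ≤ suc d → ℕ
      R i i≤ = rows (sub M (rowPrefix i i≤ X) (colPrefix i Y))
      -- The first row prefix has length `D`, which is positive.
      many₀ : 1 ≤ R 0 z≤n
      many₀ = 1≤distinct (λ i → tabulate (sub M (rowPrefix 0 z≤n X) (colPrefix 0 Y) i))
        (≤-trans 1≤D (≤-reflexive (sym (trans (α≡ 0) (*-identityʳ D)))))
      shrink : ∀ i (i<e : i < suc d) → HasCover s (sub M (rowPrefix (suc i) i<e X) (colPrefix (suc i) Y)) d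
      shrink i i<e = cover-truncate M (α-mono i<e) (α-mono i<e) (β-anti {0} {suc i} z≤n) (β-anti {0} {i} z≤n)
        ≤-refl (β-anti {i} {suc i} (n≤1+n i)) (passes i i<e)
      -- A cover by `d` rectangles leaves at most `2 ^ d` distinct rows.
      few : ¬ 2 ^ suc d ≤ R (suc d) ≤-refl
      few 2^≤ = <⇒≱ (^-monoʳ-< 2 (s≤s (s≤s z≤n)) (n<1+n d)) (≤-trans 2^≤ (rows≤2^d (shrink d ≤-refl)))
      finish : (∃ λ i → Σ[ i<e ∈ i < suc d ] 2 ^ i ≤ R i (<⇒≤ i<e) × ¬ 2 ^ suc i ≤ R (suc i) i<e) →
               ∃ λ i → Σ[ i<e ∈ i < suc d ] EventAt M X Y i i<e
      finish (i , i<e , many , ¬many) = i , i<e , shrink i i<e , few-rows , few-cols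
        where
        few-rows : R (suc i) i<e ≤ rowBound i
        few-rows = s≤s⁻¹ (≤-trans (≰⇒> ¬many) (≤-reflexive (sym (suc-rowBound i))))
        few-cols : cols (sub M (rowPrefix (suc i) i<e X) (colPrefix (suc i) Y)) ≤ colBound i
        -- In the tested grid at least `2 ^ i` rows are visible from step `i`, and all the columns
        -- from step `suc i`; the product bound for that grid then limits the columns.
        few-cols = *-cancelˡ-≤ (2 ^ i) {{m^n≢0 2 i}} (begin
          2 ^ i * cols (sub M (rowPrefix (suc i) i<e X) (colPrefix (suc i) Y))
            ≤⟨ *-mono-≤
                 (≤-trans many (rows-truncate M (α-mono (<⇒≤ i<e)) (α-mono i<e) (β-anti {0} {i} z≤n) (β-anti {0} {i} z≤n)
                   (α-mono (n≤1+n i)) ≤-refl))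
                 (rows-truncate (flip M) (β-anti {0} {suc i} z≤n) (β-anti {0} {i} z≤n) (α-mono i<e) (α-mono i<e)
                   (β-anti {i} {suc i} (n≤1+n i)) ≤-refl) ⟩
          rows (sub M (rowPrefix (suc i) i<e X) (colPrefix i Y)) * cols (sub M (rowPrefix (suc i) i<e X) (colPrefix i Y))
            ≤⟨ rows*cols≤ (passes i i<e) ⟩
          (d C≤ s) * 2 ^ d
            ≡⟨ cong (λ e → (d C≤ s) * 2 ^ e) (m+[n∸m]≡n (s≤s⁻¹ i<e)) ⟨
          (d C≤ s) * 2 ^ (i + (d ∸ i))
            ≡⟨ cong ((d C≤ s) *_) (^-distribˡ-+-* 2 i (d ∸ i)) ⟩
          (d C≤ s) * (2 ^ i * 2 ^ (d ∸ i))
            ≡⟨ rotate (d C≤ s) (2 ^ i) (2 ^ (d ∸ i)) ⟩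
          2 ^ i * colBound i ∎)
          where
          open ≤-Reasoning
          rotate : ∀ x y z → x * (y * z) ≡ y * (x * z)
          rotate = solve-∀

    Sample : Set
    Sample = Vec (Fin n) (α (suc d)) × Vec (Fin m) (β 0)

    samplesList : List Sample
    samplesList = cartesianProduct (vectors (allFin n) (α (suc d))) (vectors (allFin m) (β 0))

    length-samplesList : length samplesList ≡ n ^ α (suc d) * m ^ β 0
    length-samplesList = trans (length-product _,_ (vectors (allFin n) (α (suc d))) (vectors (allFin m) (β 0)))
      (length-samples (α (suc d)) (β 0))

    eventAt? : ∀ M (σ : Sample) i i<e → Dec (EventAt M (proj₁ σ) (proj₂ σ) i i<e)
    eventAt? M (X , Y) i i<e = event? M s d (rowBound i) (colBound i) (rowPrefix (suc i) i<e X) (colPrefix (suc i) Y)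

    eventCount : Matrix n m → Sample → ℕ
    eventCount M σ = ∑ (allFin (suc d)) λ i → #[ eventAt? M σ (toℕ i) (Fin.toℕ<n i) ]

    EventAt-transport : ∀ M X Y {i j} {i<e : i < suc d} {j<e : j < suc d} → i ≡ j →
                        EventAt M X Y i i<e → EventAt M X Y j j<e
    EventAt-transport M X Y {i} {i<e = i<e} {j<e} refl = subst (EventAt M X Y i) (≤-irrelevant i<e j<e)

    event⇒1≤eventCount : ∀ M σ i i<e → EventAt M (proj₁ σ) (proj₂ σ) i i<e → 1 ≤ eventCount M σ
    event⇒1≤eventCount M σ i i<e event = ≤-trans
      (1≤# (eventAt? M σ (toℕ k) (Fin.toℕ<n k)) (EventAt-transport M (proj₁ σ) (proj₂ σ) (sym (Fin.toℕ-fromℕ< i<e)) event))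
      (term≤∑ (λ i → #[ eventAt? M σ (toℕ i) (Fin.toℕ<n i) ]) k)
      where k = fromℕ< i<e

    -- The event depends on the prefixes of step `suc i` alone, and by `∑-truncate` all pairs of
    -- prefixes extend to equally many samples.
    event-rareAt : ∀ .{{_ : NonZero n}} .{{_ : NonZero m}} {Q} (M : Matrix n m) →
                   (∀ M′ → HasCover s M′ d → n * m ≤ Q * distance M M′) → ∀ i i<e →
                   D * ∑ samplesList (λ σ → #[ eventAt? M σ i i<e ]) ≤ 2 * Q * length samplesList
    event-rareAt {Q} M far i i<e = begin
      D * ∑ samplesList (λ σ → #[ eventAt? M σ i i<e ])
        ≡⟨ cong (D *_) (∑-product _,_ (vectors (allFin n) A) (vectors (allFin m) B) _) ⟩
      D * ∑ (vectors (allFin n) A) (λ X → ∑ (vectors (allFin m) B) λ Y → h (truncate a≤A X) (truncate b≤B Y))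
        ≡⟨ cong (D *_) (∑-truncate (allFin n) a≤A (λ X → ∑ (vectors (allFin m) B) λ Y → h X (truncate b≤B Y))) ⟩
      D * (length (allFin n) ^ (A ∸ a) * ∑ (vectors (allFin n) a) (λ X → ∑ (vectors (allFin m) B) λ Y → h X (truncate b≤B Y)))
        ≡⟨ cong (λ z → D * (length (allFin n) ^ (A ∸ a) * z)) (trans
             (∑-cong (vectors (allFin n) a) λ X → ∑-truncate (allFin m) b≤B (h X))
             (∑-* (length (allFin m) ^ (B ∸ b)) (vectors (allFin n) a) λ X → ∑ (vectors (allFin m) b) (h X))) ⟩
      D * (length (allFin n) ^ (A ∸ a) * (length (allFin m) ^ (B ∸ b) * O))
        ≡⟨ cong₂ (λ x y → D * (x ^ (A ∸ a) * (y ^ (B ∸ b) * O))) (length-allFin n) (length-allFin m) ⟩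
      D * (n ^ (A ∸ a) * (m ^ (B ∸ b) * O))
        ≡⟨ shuffle₁ D (n ^ (A ∸ a)) (m ^ (B ∸ b)) O ⟩
      n ^ (A ∸ a) * m ^ (B ∸ b) * (D * O)
        ≤⟨ *-monoʳ-≤ (n ^ (A ∸ a) * m ^ (B ∸ b)) (event-rare M s d (rowBound i) (colBound i) {Q = Q} {D} D*t D*u far) ⟩
      n ^ (A ∸ a) * m ^ (B ∸ b) * (2 * Q * (n ^ a * m ^ b))
        ≡⟨ shuffle₂ (n ^ (A ∸ a)) (m ^ (B ∸ b)) (2 * Q) (n ^ a) (m ^ b) ⟩
      2 * Q * (n ^ (A ∸ a) * n ^ a * (m ^ (B ∸ b) * m ^ b))
        ≡⟨ cong₂ (λ x y → 2 * Q * (x * y)) (join n a≤A) (join m b≤B) ⟩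
      2 * Q * (n ^ A * m ^ B)
        ≡⟨ cong (2 * Q *_) length-samplesList ⟨
      2 * Q * length samplesList ∎
      where
      open ≤-Reasoning
      A = α (suc d)
      a = α (suc i)
      B = β 0
      b = β (suc i)
      a≤A : a ≤ A
      a≤A = α-mono i<e
      b≤B : b ≤ B
      b≤B = β-anti {0} {suc i} z≤n
      h : Vec (Fin n) a → Vec (Fin m) b → ℕ
      h X Y = #[ event? M s d (rowBound i) (colBound i) X Y ]
      O = occurrences M s d (rowBound i) (colBound i) {a} {b}
      D*t : D * suc (rowBound i) ≤ suc a
      D*t = ≤-trans (≤-reflexive (trans (cong (D *_) (suc-rowBound i)) (sym (α≡ (suc i))))) (n≤1+n a)
      D*u : D * suc (colBound i) ≤ suc b
      D*u = ≤-trans (≤-reflexive (sym (β≡ (suc i)))) (n≤1+n b)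
      join : ∀ n {a A} → a ≤ A → n ^ (A ∸ a) * n ^ a ≡ n ^ A
      join n {a} {A} a≤A = trans (sym (^-distribˡ-+-* n (A ∸ a) a)) (cong (n ^_) (m∸n+n≡m a≤A))
      shuffle₁ : ∀ D x y z → D * (x * (y * z)) ≡ x * y * (D * z)
      shuffle₁ = solve-∀
      shuffle₂ : ∀ x y q u v → x * y * (q * (u * v)) ≡ q * (x * u * (y * v))
      shuffle₂ = solve-∀

    -- Union bound over the `suc d` steps.
    eventCount-rare : ∀ .{{_ : NonZero n}} .{{_ : NonZero m}} {Q} (M : Matrix n m) →
                      (∀ M′ → HasCover s M′ d → n * m ≤ Q * distance M M′) →
                      D * ∑ samplesList (eventCount M) ≤ suc d * (2 * Q * length samplesList)
    eventCount-rare {Q} M far = begin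
      D * ∑ samplesList (eventCount M)
        ≡⟨ cong (D *_) (∑-swap samplesList (allFin (suc d)) _) ⟩
      D * ∑ (allFin (suc d)) (λ i → ∑ samplesList λ σ → #[ eventAt? M σ (toℕ i) (Fin.toℕ<n i) ])
        ≡⟨ ∑-* D (allFin (suc d)) _ ⟨
      ∑ (allFin (suc d)) (λ i → D * ∑ samplesList λ σ → #[ eventAt? M σ (toℕ i) (Fin.toℕ<n i) ])
        ≤⟨ ∑-mono (allFin (suc d)) (λ i → event-rareAt {Q} M far (toℕ i) (Fin.toℕ<n i)) ⟩
      ∑ (allFin (suc d)) (λ _ → 2 * Q * length samplesList)
        ≡⟨ ∑-allFin-const (suc d) ⟩
      suc d * (2 * Q * length samplesList) ∎
      where open ≤-Reasoning

    grid : Sample → Fin (suc d) → List (Fin n × Fin m)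
    grid (X , Y) i = cartesianProduct (Vec.toList (rowPrefix (suc (toℕ i)) (Fin.toℕ<n i) X)) (Vec.toList (colPrefix (toℕ i) Y))

    gridQueries : Sample → List (Fin n × Fin m)
    gridQueries σ = concatMap (grid σ) (allFin (suc d))

-- The canonical one-sided verdict: accept when some matrix with the property answers the queries likewise.
module Consistency {n m} (P : Property n m) (P? : ∀ M → Dec (P M)) (resp : ∀ {M M′} → M ≐ M′ → P M → P M′) where

  read : Matrix n m → Fin n × Fin m → Bool
  read M (i , j) = M i j

  Consistent : List (Fin n × Fin m) → List Bool → Set
  Consistent qs answers = ∃ λ M → P M × List.map (read M) qs ≡ answers

  searchMatrix : ∀ {R : Matrix n m → Set} → (∀ {M M′} → M ≐ M′ → R M → R M′) → (∀ M → Dec (R M)) → Dec (∃ R)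
  searchMatrix R-resp R? = map′
    (λ (V , r) → decode V , r)
    (λ (M , r) → encode M , R-resp (λ i j → sym (decode-encode M i j)) r)
    (search (vectors (subsets m) n) (∈-vectors (subsets m) ∈-subsets) (R? ∘ decode))
    where
    decode : Vec (Subset m) n → Matrix n m
    decode V i j = lookup (lookup V i) j
    encode : Matrix n m → Vec (Subset m) n
    encode M = tabulate (tabulate ∘ M)
    decode-encode : ∀ M → decode (encode M) ≐ M
    decode-encode M i j = trans (cong (λ v → lookup v j) (Vec.lookup∘tabulate (tabulate ∘ M) i)) (Vec.lookup∘tabulate (M i) j)

  abstract
    property? : Dec (∃ P)
    property? = searchMatrix resp P?

    consistent? : ∀ qs answers → Dec (Consistent qs answers)
    consistent? qs answers = searchMatrix
      (λ M≐ (p , eq) → resp M≐ p , trans (List.map-cong (λ (i , j) → sym (M≐ i j)) qs) eq)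
      (λ M → P? M ×-dec List.≡-dec Bool._≟_ (List.map (read M) qs) answers)

  module _ {S : Set} (σs : List S) {{_ : NonZero (length σs)}} (qs : S → List (Fin n × Fin m)) where

    tester : NonAdaptiveTester n m
    tester = record
      { seeds   = length σs
      ; queries = λ ρ → qs (List.lookup σs ρ)
      ; verdict = λ ρ answers → does (consistent? (qs (List.lookup σs ρ)) answers)
      }

    accepts? : ∀ M σ → Dec (Consistent (qs σ) (List.map (read M) (qs σ)))
    accepts? M σ = consistent? (qs σ) (List.map (read M) (qs σ))

    accepting-count : ∀ M → ∣ accepting tester M ∣ ≡ ∑ σs (λ σ → #[ accepts? M σ ])
    accepting-count M = begin
      ∣ accepting tester M ∣                                     ≡⟨ ∣tabulate∣ (λ ρ → does (accepts? M (List.lookup σs ρ))) ⟩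
      Vec.sum (tabulate λ ρ → #[ accepts? M (List.lookup σs ρ) ]) ≡⟨ ∑-tabulate (List.lookup σs) (λ σ → #[ accepts? M σ ]) ⟨
      ∑ (List.tabulate (List.lookup σs)) (λ σ → #[ accepts? M σ ]) ≡⟨ cong (λ xs → ∑ xs (λ σ → #[ accepts? M σ ])) (List.tabulate-lookup σs) ⟩
      ∑ σs (λ σ → #[ accepts? M σ ]) ∎
      where open ≡-Reasoning

    accepting-all : ∀ M → P M → ∣ accepting tester M ∣ ≡ length σs
    accepting-all M p = begin
      ∣ accepting tester M ∣             ≡⟨ accepting-count M ⟩
      ∑ σs (λ σ → #[ accepts? M σ ])     ≡⟨ ∑-cong σs (λ σ → cong bit (dec-true (accepts? M σ) (M , p , refl))) ⟩
      ∑ σs (λ σ → 1)                     ≡⟨ length≡∑ σs ⟨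
      length σs                          ∎
      where open ≡-Reasoning

-- Sampling parameters and query count

map-agree : ∀ {A B : Set} {f g : A → B} {xs x} → List.map f xs ≡ List.map g xs → x ∈ xs → f x ≡ g x
map-agree {xs = x ∷ xs} eq (here refl) = List.∷-injectiveˡ eq
map-agree {xs = x ∷ xs} eq (there x∈)  = map-agree (List.∷-injectiveʳ eq) x∈

length-concatMap : ∀ {A B : Set} (f : A → List B) xs → length (concatMap f xs) ≡ ∑ xs (length ∘ f)
length-concatMap f []       = refl
length-concatMap f (x ∷ xs) = trans (List.length-++ (f x)) (cong (length (f x) +_) (length-concatMap f xs))

1≤C≤ : ∀ d s → 1 ≤ d C≤ s
1≤C≤ d s = m≤m+n 1 _

module Sampling (s d q : ℕ) {n m : ℕ} where

  -- Each of the d + 1 steps fails with probability at most 2 (2 q) / D, in total at most 1/3.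
  D : ℕ
  D = 12 * (suc d * q)

  open Prefixes s d D public

  -- In `α (suc i) * β i` the powers of 2 multiply to `2 ^ (d + 2)` for every `i`, and the `suc` in
  -- `β i` adds a term of at most `2 ^ (d + 1)`. This accounts for 6 = 4 + 2 multiples of `2 ^ d`.
  gridQueries-length : ∀ (σ : Sample {n} {m}) → length (gridQueries σ) ≤ suc d * (6 * (D * D) * ((d C≤ s) * 2 ^ d))
  gridQueries-length σ@(X , Y) = begin
    length (gridQueries σ)
      ≡⟨ length-concatMap (grid σ) (allFin (suc d)) ⟩
    ∑ (allFin (suc d)) (λ i → length (grid σ i))
      ≤⟨ ∑-mono (allFin (suc d)) {g = λ _ → bound} small ⟩
    ∑ (allFin (suc d)) (λ _ → bound)
      ≡⟨ ∑-allFin-const (suc d) ⟩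
    suc d * bound ∎
    where
    open ≤-Reasoning
    B = d C≤ s
    bound = 6 * (D * D) * (B * 2 ^ d)
    small : ∀ i → length (grid σ i) ≤ bound
    small k = begin
      length (grid σ k)
        ≡⟨ length-product _,_ (Vec.toList (rowPrefix (suc i) (Fin.toℕ<n k) X)) (Vec.toList (colPrefix i Y)) ⟩
      length (Vec.toList (rowPrefix (suc i) (Fin.toℕ<n k) X)) * length (Vec.toList (colPrefix i Y))
        ≡⟨ cong₂ _*_ (Vec.length-toList (rowPrefix (suc i) (Fin.toℕ<n k) X)) (Vec.length-toList (colPrefix i Y)) ⟩
      α (suc i) * β i
        ≡⟨ cong₂ _*_ (α≡ (suc i)) (β≡ i) ⟩
      D * 2 ^ suc i * (D * suc (B * 2 ^ (suc d ∸ i)))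
        ≡⟨ shuffle₁ D (2 ^ suc i) B (2 ^ (suc d ∸ i)) ⟩
      D * D * (2 ^ suc i + B * (2 ^ suc i * 2 ^ (suc d ∸ i)))
        ≡⟨ cong (λ z → D * D * (2 ^ suc i + B * z)) (trans (sym (^-distribˡ-+-* 2 (suc i) (suc d ∸ i)))
             (cong (λ e → 2 ^ suc e) (m+[n∸m]≡n (<⇒≤ (Fin.toℕ<n k))))) ⟩
      D * D * (2 ^ suc i + B * 2 ^ suc (suc d))
        ≤⟨ *-monoʳ-≤ (D * D) (+-monoˡ-≤ _ (≤-trans (^-monoʳ-≤ 2 (Fin.toℕ<n k))
             (≤-trans (≤-reflexive (sym (*-identityˡ _))) (*-monoˡ-≤ (2 ^ suc d) (1≤C≤ d s))))) ⟩
      D * D * (B * 2 ^ suc d + B * 2 ^ suc (suc d))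
        ≡⟨ shuffle₂ (D * D) B (2 ^ d) ⟩
      bound ∎
      where
      i = toℕ k
      shuffle₁ : ∀ D x B y → D * x * (D * suc (B * y)) ≡ D * D * (x + B * (x * y))
      shuffle₁ = solve-∀
      shuffle₂ : ∀ D B x → D * (B * (2 * x) + B * (2 * (2 * x))) ≡ 6 * D * (B * x)
      shuffle₂ = solve-∀

  PassesAt-transport : ∀ M X Y {i j} {i<e : i < suc d} {j<e : j < suc d} → i ≡ j →
                       PassesAt {n} {m} M X Y i i<e → PassesAt M X Y j j<e
  PassesAt-transport M X Y {i} {i<e = i<e} {j<e} refl = subst (PassesAt M X Y i) (≤-irrelevant i<e j<e)

  -- The cover of `M′` restricts to each grid, where `M` and `M′` agree.
  agree⇒passes : ∀ (M M′ : Matrix n m) σ → (∀ {i j} → (i , j) ∈ gridQueries σ → M′ i j ≡ M i j) →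
                 HasCover s M′ d → Passes M (proj₁ σ) (proj₂ σ)
  agree⇒passes M M′ σ@(X , Y) agree c i i<e =
    PassesAt-transport M X Y (Fin.toℕ-fromℕ< i<e) (cover-cong same (cover-pull (just ∘ lookup X′) (just ∘ lookup Y′) {M = M′} c))
    where
    k = fromℕ< i<e
    X′ = rowPrefix (suc (toℕ k)) (Fin.toℕ<n k) X
    Y′ = colPrefix (toℕ k) Y
    same : ∀ i j → M′ (lookup X′ i) (lookup Y′ j) ≡ M (lookup X′ i) (lookup Y′ j)
    same i j = agree (∈-concatMap⁺ (grid σ) {xs = allFin (suc d)} (lose (∈-allFin k)
      (∈-cartesianProduct⁺ (∈-toList⁺ (∈ᵛ-lookup i X′)) (∈-toList⁺ (∈ᵛ-lookup j Y′)))))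

-- Rational estimates

fromℚᵘ-mono-≤ : ∀ {p q} → p ℚᵘ.≤ q → ℚ.fromℚᵘ p ℚ.≤ ℚ.fromℚᵘ q
fromℚᵘ-mono-≤ {p} {q} p≤q = ℚ.toℚᵘ-cancel-≤
  (ℚᵘ.≤-respˡ-≃ (ℚᵘ.≃-sym (ℚ.toℚᵘ-fromℚᵘ p)) (ℚᵘ.≤-respʳ-≃ (ℚᵘ.≃-sym (ℚ.toℚᵘ-fromℚᵘ q)) p≤q))

fromℕ-mono : ∀ {k l} → k ≤ l → fromℕ k ℚ.≤ fromℕ l
fromℕ-mono {k} {l} k≤l = fromℚᵘ-mono-≤ {mkℚᵘ (ℤ.+ k) 0} {mkℚᵘ (ℤ.+ l) 0}
  (ℚᵘ.*≤* (ℤ.*-monoʳ-≤-nonNeg (ℤ.+ 1) (ℤ.+≤+ k≤l)))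

fromℕ-cancel-< : ∀ {k l} → fromℕ k ℚ.< fromℕ l → k < l
fromℕ-cancel-< {k} {l} k<l = ≰⇒> λ l≤k → ℚ.<-irrefl refl (ℚ.<-≤-trans k<l (fromℕ-mono {l} {k} l≤k))

fromℕ-cancel-≤ : ∀ {k l} → fromℕ k ℚ.≤ fromℕ l → k ≤ l
fromℕ-cancel-≤ {k} {l} k≤l = unpack (ℚᵘ.≤-respˡ-≃ (ℚ.toℚᵘ-fromℚᵘ (mkℚᵘ (ℤ.+ k) 0))
  (ℚᵘ.≤-respʳ-≃ (ℚ.toℚᵘ-fromℚᵘ (mkℚᵘ (ℤ.+ l) 0)) (ℚ.toℚᵘ-mono-≤ k≤l)))
  where
  unpack : mkℚᵘ (ℤ.+ k) 0 ℚᵘ.≤ mkℚᵘ (ℤ.+ l) 0 → k ≤ l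
  unpack (ℚᵘ.*≤* le) = ℤ.drop‿+≤+ (subst₂ ℤ._≤_ (ℤ.*-identityʳ (ℤ.+ k)) (ℤ.*-identityʳ (ℤ.+ l)) le)

fromℕ-* : ∀ k l → fromℕ (k * l) ≡ fromℕ k ℚ.* fromℕ l
fromℕ-* k l = ℚ.toℚᵘ-injective (begin-equality
  ℚ.toℚᵘ (fromℕ (k * l))                        ≃⟨ ℚ.toℚᵘ-fromℚᵘ (mkℚᵘ (ℤ.+ (k * l)) 0) ⟩
  mkℚᵘ (ℤ.+ (k * l)) 0                          ≃⟨ ℚᵘ.*≡* (cong (ℤ._* ℤ.+ 1) (ℤ.pos-* k l)) ⟩
  mkℚᵘ (ℤ.+ k) 0 ℚᵘ.* mkℚᵘ (ℤ.+ l) 0            ≃⟨ ℚᵘ.*-cong (ℚ.toℚᵘ-fromℚᵘ (mkℚᵘ (ℤ.+ k) 0)) (ℚ.toℚᵘ-fromℚᵘ (mkℚᵘ (ℤ.+ l) 0)) ⟨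
  ℚ.toℚᵘ (fromℕ k) ℚᵘ.* ℚ.toℚᵘ (fromℕ l)        ≃⟨ ℚ.toℚᵘ-homo-* (fromℕ k) (fromℕ l) ⟨
  ℚ.toℚᵘ (fromℕ k ℚ.* fromℕ l)                  ∎)
  where open ℚᵘ.≤-Reasoning

2/3≤ : ∀ a b {{_ : NonZero b}} → 2 * b ≤ 3 * a → ℤ.+ 2 ℚ./ 3 ℚ.≤ ℤ.+ a ℚ./ b
2/3≤ a (suc b) 2b≤3a = fromℚᵘ-mono-≤ {mkℚᵘ (ℤ.+ 2) 2} {mkℚᵘ (ℤ.+ a) b}
  (ℚᵘ.*≤* (subst₂ ℤ._≤_ (ℤ.pos-* 2 (suc b)) (ℤ.pos-* a 3) (ℤ.+≤+ (≤-trans 2b≤3a (≤-reflexive (*-comm 3 a))))))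

n/n≡1 : ∀ n {{_ : NonZero n}} → ℤ.+ n ℚ./ n ≡ 1ℚ
n/n≡1 (suc n) = ℚ.fromℚᵘ-cong {mkℚᵘ (ℤ.+ suc n) n} {mkℚᵘ (ℤ.+ 1) 0}
  (ℚᵘ.*≡* (trans (ℤ.*-identityʳ (ℤ.+ suc n)) (sym (ℤ.*-identityˡ (ℤ.+ suc n)))))

ceilingℕ : ℚ → ℕ
ceilingℕ p = ℤ.∣ ℚ.ceiling p ∣

-- ⌈ (a + 1) / (d + 1) ⌉, in the form to which ℚ.ceiling reduces.
ceil : ∀ a d → ℕ
ceil a d = ℤ.∣ ℤ.- (ℤ.-[1+ a ] ℤ./ ℤ.+[1+ d ]) ∣

ceil-bounds : ∀ a d → suc a ≤ ceil a d * suc d × ceil a d * suc d < suc a + suc d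
ceil-bounds a d = subst (λ c → suc a ≤ c * suc d × c * suc d < suc a + suc d)
  (cong (λ z → ℤ.∣ ℤ.- z ∣) (sym (ℤ.div-pos-is-/ℕ ℤ.-[1+ a ] (suc d)))) bounds
  where
  bounds : let c = ℤ.∣ ℤ.- (ℤ.-[1+ a ] ℤ./ℕ suc d) ∣ in suc a ≤ c * suc d × c * suc d < suc a + suc d
  -- Division of a negative integer branches on whether the remainder of its absolute value
  -- vanishes.
  bounds with suc a % suc d | m≡m%n+[m/n]*n (suc a) (suc d) | m%n<n (suc a) (suc d)
  ... | zero  | eq | _   rewrite ℤ.neg-involutive (ℤ.+ (suc a / suc d)) =
    ≤-reflexive eq , ≤-trans (s≤s (≤-reflexive (sym eq))) (≤-trans (m≤m+n _ d) (≤-reflexive (sym (+-suc (suc a) d))))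
  ... | suc r | eq | r<d =
    ≤-trans (≤-reflexive eq) (+-monoˡ-≤ _ (<⇒≤ r<d)) ,
    ≤-trans (s≤s (≤-reflexive (+-comm (suc d) _))) (+-monoˡ-≤ (suc d) (≤-trans (s≤s (m≤n+m _ r)) (≤-reflexive (sym eq))))

ceiling-upper : ∀ p .{{_ : Positive p}} → p ℚ.≤ fromℕ (ceilingℕ p)
ceiling-upper p@(mkℚ ℤ.+[1+ a ] d _) = ℚ.toℚᵘ-cancel-≤ (ℚᵘ.≤-respʳ-≃ (ℚᵘ.≃-sym (ℚ.toℚᵘ-fromℚᵘ (mkℚᵘ (ℤ.+ ceil a d) 0)))
  (ℚᵘ.*≤* (subst₂ ℤ._≤_ (sym (ℤ.*-identityʳ ℤ.+[1+ a ])) (ℤ.pos-* (ceil a d) (suc d)) (ℤ.+≤+ (proj₁ (ceil-bounds a d))))))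

ceiling-least : ∀ p .{{_ : Positive p}} {k} → p ℚ.≤ fromℕ k → ceilingℕ p ≤ k
ceiling-least p@(mkℚ ℤ.+[1+ a ] d _) {k} p≤k = s≤s⁻¹ (*-cancelʳ-< (suc d) (ceil a d) (suc k) (begin-strict
  ceil a d * suc d     <⟨ proj₂ (ceil-bounds a d) ⟩
  suc a + suc d        ≤⟨ +-monoˡ-≤ (suc d) (unpack (ℚᵘ.≤-respʳ-≃ (ℚ.toℚᵘ-fromℚᵘ (mkℚᵘ (ℤ.+ k) 0)) (ℚ.toℚᵘ-mono-≤ p≤k))) ⟩
  k * suc d + suc d    ≡⟨ +-comm _ (suc d) ⟩
  suc k * suc d        ∎))
  where
  open ≤-Reasoning
  unpack : mkℚᵘ ℤ.+[1+ a ] d ℚᵘ.≤ mkℚᵘ (ℤ.+ k) 0 → suc a ≤ k * suc d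
  unpack (ℚᵘ.*≤* le) = ℤ.drop‿+≤+ (subst₂ ℤ._≤_ (ℤ.*-identityʳ ℤ.+[1+ a ]) (sym (ℤ.pos-* k (suc d))) le)

-- Rounding up adds less than 1, hence less than `p`.
ceiling-double : ∀ p .{{_ : Positive p}} → 1ℚ ℚ.≤ p → fromℕ (ceilingℕ p) ℚ.≤ fromℕ 2 ℚ.* p
ceiling-double p@(mkℚ ℤ.+[1+ a ] d _) 1≤p = ℚ.toℚᵘ-cancel-≤
  (ℚᵘ.≤-respˡ-≃ (ℚᵘ.≃-sym (ℚ.toℚᵘ-fromℚᵘ (mkℚᵘ (ℤ.+ ceil a d) 0)))
  (ℚᵘ.≤-respʳ-≃ (ℚᵘ.≃-sym (ℚ.toℚᵘ-homo-* (fromℕ 2) p))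
  (ℚᵘ.*≤* (subst₂ ℤ._≤_ left right (ℤ.+≤+ (begin
    ceil a d * (1 * suc d)        ≡⟨ cong (ceil a d *_) (*-identityˡ (suc d)) ⟩
    ceil a d * suc d              ≤⟨ <⇒≤ (proj₂ (ceil-bounds a d)) ⟩
    suc a + suc d                 ≤⟨ +-monoʳ-≤ (suc a) (unpack (ℚ.toℚᵘ-mono-≤ 1≤p)) ⟩
    suc a + suc a                 ≡⟨ twice (suc a) ⟩
    2 * suc a * 1                 ∎))))))
  where
  open ≤-Reasoning
  twice : ∀ a → a + a ≡ 2 * a * 1
  twice = solve-∀
  left : ℤ.+ (ceil a d * (1 * suc d)) ≡ ℤ.+ ceil a d ℤ.* ℤ.+ (1 * suc d)
  left = ℤ.pos-* (ceil a d) (1 * suc d)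
  right : ℤ.+ (2 * suc a * 1) ≡ ℤ.+ 2 ℤ.* ℤ.+ suc a ℤ.* ℤ.+ 1
  right = trans (ℤ.pos-* (2 * suc a) 1) (cong (ℤ._* ℤ.+ 1) (ℤ.pos-* 2 (suc a)))
  unpack : mkℚᵘ (ℤ.+ 1) 0 ℚᵘ.≤ mkℚᵘ ℤ.+[1+ a ] d → suc d ≤ suc a
  unpack (ℚᵘ.*≤* le) = ℤ.drop‿+≤+ (subst₂ ℤ._≤_ (ℤ.*-identityˡ (ℤ.+ suc d)) (ℤ.*-identityʳ ℤ.+[1+ a ]) le)

-- Strong induction by halving, which lowers the logarithm by one; for `n` at least 2 the logarithm
-- is at least 1, so the truncated subtraction is exact.
n≤2^⌈log₂n⌉ : ∀ n → n ≤ 2 ^ ⌈log₂ n ⌉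
n≤2^⌈log₂n⌉ = <-rec _ step
  where
  step : ∀ n → (∀ {k} → k < n → k ≤ 2 ^ ⌈log₂ k ⌉) → n ≤ 2 ^ ⌈log₂ n ⌉
  step zero          rec = z≤n
  step (suc zero)    rec = ≤-refl
  step n@(suc (suc k)) rec = begin
    n                                   ≡⟨ ⌊n/2⌋+⌈n/2⌉≡n n ⟨
    ⌊ n /2⌋ + ⌈ n /2⌉                   ≤⟨ +-monoˡ-≤ ⌈ n /2⌉ (⌊n/2⌋≤⌈n/2⌉ n) ⟩
    ⌈ n /2⌉ + ⌈ n /2⌉                   ≡⟨ cong (⌈ n /2⌉ +_) (+-identityʳ ⌈ n /2⌉) ⟨
    2 * ⌈ n /2⌉                         ≤⟨ *-monoʳ-≤ 2 (rec (⌈n/2⌉<n k)) ⟩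
    2 ^ suc ⌈log₂ ⌈ n /2⌉ ⌉             ≡⟨ cong (λ e → 2 ^ suc e) (⌈log₂⌈n/2⌉⌉≡⌈log₂n⌉∸1 n) ⟩
    2 ^ suc (⌈log₂ n ⌉ ∸ 1)             ≡⟨ cong (2 ^_) (m+[n∸m]≡n {1} (⌈log₂⌉-mono-≤ {2} {n} (s≤s (s≤s z≤n)))) ⟩
    2 ^ ⌈log₂ n ⌉                       ∎
    where open ≤-Reasoning

n≤2^k⇒⌈log₂n⌉≤k : ∀ {n} k → n ≤ 2 ^ k → ⌈log₂ n ⌉ ≤ k
n≤2^k⇒⌈log₂n⌉≤k k n≤ = ≤-trans (⌈log₂⌉-mono-≤ n≤) (≤-reflexive (⌈log₂2^n⌉≡n k))

2^k≤n⇒k≤⌈log₂n⌉ : ∀ {n} k → 2 ^ k ≤ n → k ≤ ⌈log₂ n ⌉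
2^k≤n⇒k≤⌈log₂n⌉ k ≤n = ≤-trans (≤-reflexive (sym (⌈log₂2^n⌉≡n k))) (⌈log₂⌉-mono-≤ ≤n)

⌈log₂*⌉ : ∀ a b → ⌈log₂ (a * b) ⌉ ≤ ⌈log₂ a ⌉ + ⌈log₂ b ⌉
⌈log₂*⌉ a b = n≤2^k⇒⌈log₂n⌉≤k (⌈log₂ a ⌉ + ⌈log₂ b ⌉) (≤-trans
  (*-mono-≤ (n≤2^⌈log₂n⌉ a) (n≤2^⌈log₂n⌉ b)) (≤-reflexive (sym (^-distribˡ-+-* 2 ⌈log₂ a ⌉ ⌈log₂ b ⌉))))

n≤2^n : ∀ n → n ≤ 2 ^ n
n≤2^n zero    = z≤n
n≤2^n (suc n) = +-mono-≤ (m^n>0 2 n) (≤-trans (n≤2^n n) (m≤m+n (2 ^ n) 0))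

0≤fromℕ : ∀ k → 0ℚ ℚ.≤ fromℕ k
0≤fromℕ k = fromℕ-mono {0} {k} z≤n

ℚ-*-mono-≤ : ∀ {a b c d} → 0ℚ ℚ.≤ a → 0ℚ ℚ.≤ d → a ℚ.≤ b → c ℚ.≤ d → a ℚ.* c ℚ.≤ b ℚ.* d
ℚ-*-mono-≤ {a} {b} {c} {d} 0≤a 0≤d a≤b c≤d = ℚ.≤-trans
  (ℚ.*-monoˡ-≤-nonNeg a {{ℚ.nonNegative 0≤a}} c≤d) (ℚ.*-monoʳ-≤-nonNeg d {{ℚ.nonNegative 0≤d}} a≤b)

-- Comparison of the query count with T log T, and of T log T with the polylogarithmic bound

module Accuracy (ε : ℚ) .{{_ : Positive ε}} (ε<1 : ε ℚ.< 1ℚ) where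

  y : ℚ
  y = inverse ε

  -- An integer in place of `1 / ε`; since `1 / ε` exceeds 1, rounding at most doubles it.
  q : ℕ
  q = ceilingℕ y

  ε*y≡1 : ε ℚ.* y ≡ 1ℚ
  ε*y≡1 = ℚ.*-inverseʳ ε {{ℚ.pos⇒nonZero ε}}

  instance
    y-positive : Positive y
    y-positive = ℚ.1/pos⇒pos ε

  1<y : 1ℚ ℚ.< y
  1<y = subst₂ ℚ._<_ ε*y≡1 (ℚ.*-identityˡ y) (ℚ.*-monoˡ-<-pos y ε<1)

  0≤y : 0ℚ ℚ.≤ y
  0≤y = ℚ.≤-trans (0≤fromℕ 1) (ℚ.<⇒≤ 1<y)

  y≤q : y ℚ.≤ fromℕ q
  y≤q = ceiling-upper y

  q≤2y : fromℕ q ℚ.≤ fromℕ 2 ℚ.* y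
  q≤2y = ceiling-double y (ℚ.<⇒≤ 1<y)

  1<q : 1 < q
  1<q = fromℕ-cancel-< {1} {q} (ℚ.<-≤-trans 1<y y≤q)

  far⇒ : ∀ {k δ} → ε ℚ.* fromℕ k ℚ.< fromℕ δ → k < q * δ
  far⇒ {k} {δ} εk<δ = fromℕ-cancel-< {k} {q * δ} (begin-strict
    fromℕ k                      ≡⟨ ℚ.*-identityˡ (fromℕ k) ⟨
    1ℚ ℚ.* fromℕ k               ≡⟨ cong (ℚ._* fromℕ k) (trans (sym ε*y≡1) (ℚ.*-comm ε y)) ⟩
    y ℚ.* ε ℚ.* fromℕ k          ≡⟨ ℚ.*-assoc y ε (fromℕ k) ⟩
    y ℚ.* (ε ℚ.* fromℕ k)        <⟨ ℚ.*-monoʳ-<-pos y εk<δ ⟩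
    y ℚ.* fromℕ δ                ≤⟨ ℚ-*-mono-≤ 0≤y (0≤fromℕ δ) y≤q ℚ.≤-refl ⟩
    fromℕ q ℚ.* fromℕ δ          ≡⟨ fromℕ-* q δ ⟨
    fromℕ (q * δ)                ∎)
    where open ℚ.≤-Reasoning

  module _ (s d : ℕ) (1≤d : 1 ≤ d) where

    B N Z : ℕ
    B = d C≤ s
    N = B * 2 ^ d
    Z = 324 * d ^ 2 * B * 2 ^ d

    Z≡ : Z ≡ 324 * (d * d) * N
    Z≡ = trans (cong (λ d² → 324 * d² * B * 2 ^ d) (cong (d *_) (*-identityʳ d))) (*-assoc (324 * (d * d)) B (2 ^ d))

    2^d≤N : 2 ^ d ≤ N
    2^d≤N = ≤-trans (≤-reflexive (sym (*-identityˡ _))) (*-monoˡ-≤ (2 ^ d) (1≤C≤ d s))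

    2^d≤Z : 2 ^ d ≤ Z
    2^d≤Z = ≤-trans 2^d≤N (≤-trans (≤-trans (≤-reflexive (sym (*-identityˡ N)))
      (*-monoˡ-≤ N (*-mono-≤ {1} {324} (s≤s z≤n) (*-mono-≤ 1≤d 1≤d)))) (≤-reflexive (sym Z≡)))

    Z≤T : fromℕ Z ℚ.≤ T s d ε
    Z≤T = ℚ.≤-trans (ℚ.≤-reflexive (sym (ℚ.*-identityʳ (fromℕ Z))))
      (ℚ-*-mono-≤ (0≤fromℕ Z) (ℚ.≤-trans (0≤fromℕ 1) 1≤y²) ℚ.≤-refl 1≤y²)
      where
      1≤y² : 1ℚ ℚ.≤ y ℚ.* y
      1≤y² = ℚ-*-mono-≤ (0≤fromℕ 1) 0≤y (ℚ.<⇒≤ 1<y) (ℚ.<⇒≤ 1<y)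

    instance
      T-positive : Positive (T s d ε)
      T-positive = ℚ.positive (ℚ.<-≤-trans (ℚ.positive⁻¹ (fromℕ 1)) (ℚ.≤-trans (fromℕ-mono {1} {Z} (≤-trans (m^n>0 2 d) 2^d≤Z)) Z≤T))

    -- The testers make a number of queries cubic in `d` where `T` is only quadratic. The logarithm
    -- supplies the third factor, because `T` is at least `2 ^ d`.
    d≤logT : d ≤ log (T s d ε)
    d≤logT = 2^k≤n⇒k≤⌈log₂n⌉ d (fromℕ-cancel-≤ {2 ^ d} {ceilingℕ (T s d ε)} (ℚ.≤-trans (fromℕ-mono {2 ^ d} {Z} 2^d≤Z) (ℚ.≤-trans Z≤T (ceiling-upper (T s d ε)))))

    -- The factor `d` is absorbed by `log T`, and `q ≤ 2 * y` applied twice gives 88 = 22 * 2 * 2.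
    ≤TlogT : ∀ {k} → k ≤ 22 * (Z * d) * (q * q) → fromℕ k ℚ.≤ fromℕ 88 ℚ.* TlogT s d ε
    ≤TlogT {k} k≤ = begin
      fromℕ k
        ≤⟨ fromℕ-mono {k} {22 * (Z * d) * (q * q)} k≤ ⟩
      fromℕ (22 * (Z * d) * (q * q))
        ≡⟨ trans (fromℕ-* (22 * (Z * d)) (q * q)) (cong₂ ℚ._*_ (trans (fromℕ-* 22 (Z * d)) (cong (fromℕ 22 ℚ.*_) (fromℕ-* Z d))) (fromℕ-* q q)) ⟩
      fromℕ 22 ℚ.* (fromℕ Z ℚ.* fromℕ d) ℚ.* (fromℕ q ℚ.* fromℕ q)
        ≤⟨ ℚ-*-mono-≤ (subst (0ℚ ℚ.≤_) (trans (fromℕ-* 22 (Z * d)) (cong (fromℕ 22 ℚ.*_) (fromℕ-* Z d))) (0≤fromℕ (22 * (Z * d))))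
             (0≤² 0≤2y) ℚ.≤-refl (ℚ-*-mono-≤ (0≤fromℕ q) 0≤2y q≤2y q≤2y) ⟩
      fromℕ 22 ℚ.* (fromℕ Z ℚ.* fromℕ d) ℚ.* (fromℕ 2 ℚ.* y ℚ.* (fromℕ 2 ℚ.* y))
        ≡⟨ shuffle (fromℕ 22) (fromℕ Z) (fromℕ d) (fromℕ 2) y ⟩
      fromℕ 22 ℚ.* (fromℕ 2 ℚ.* fromℕ 2) ℚ.* (T s d ε ℚ.* fromℕ d)
        ≡⟨⟩
      fromℕ 88 ℚ.* (T s d ε ℚ.* fromℕ d)
        ≤⟨ ℚ.*-monoˡ-≤-nonNeg (fromℕ 88) (ℚ.*-monoˡ-≤-nonNeg (T s d ε) {{ℚ.pos⇒nonNeg (T s d ε)}} (fromℕ-mono {d} {log (T s d ε)} d≤logT)) ⟩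
      fromℕ 88 ℚ.* TlogT s d ε ∎
      where
      open ℚ.≤-Reasoning
      0≤2y : 0ℚ ℚ.≤ fromℕ 2 ℚ.* y
      0≤2y = ℚ.≤-trans (0≤fromℕ q) q≤2y
      0≤² : ∀ {x} → 0ℚ ℚ.≤ x → 0ℚ ℚ.≤ x ℚ.* x
      0≤² {x} 0≤x = ℚ.≤-trans (ℚ.≤-reflexive (sym (ℚ.*-zeroˡ x))) (ℚ.*-monoʳ-≤-nonNeg x {{ℚ.nonNegative 0≤x}} 0≤x)
      shuffle : ∀ a z d b y → a ℚ.* (z ℚ.* d) ℚ.* (b ℚ.* y ℚ.* (b ℚ.* y)) ≡ a ℚ.* (b ℚ.* b) ℚ.* (z ℚ.* (y ℚ.* y) ℚ.* d)
      shuffle = solve 5 (λ a z d b y → a :* (z :* d) :* (b :* y :* (b :* y)) := a :* (b :* b) :* (z :* (y :* y) :* d)) refl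
        where open ℚ.+-*-Solver

    L Lε : ℕ
    L  = log (fromℕ N)
    Lε = log y

    N≤ceiling : N ≤ ceilingℕ (fromℕ N)
    N≤ceiling = fromℕ-cancel-≤ {N} {ceilingℕ (fromℕ N)} (ceiling-upper (fromℕ N) {{N-positive}})
      where
      N-positive : Positive (fromℕ N)
      N-positive = ℚ.positive (ℚ.<-≤-trans (ℚ.positive⁻¹ (fromℕ 1)) (fromℕ-mono {1} {N} (≤-trans (m^n>0 2 d) 2^d≤N)))

    -- The logarithm of 324 is at most 9, as 324 + 188 = 512, and that of `d` is at most `d`. Since
    -- `1 ≤ d ≤ L` and `1 ≤ Lε`, each unit, `d`, `L` and `Lε` is at most `L * Lε`, in all 9 + 2 + 1
    -- + 2 = 14 times.
    logT≤ : log (T s d ε) ≤ 14 * (L * Lε)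
    logT≤ = begin
      log (T s d ε)
        ≤⟨ ⌈log₂⌉-mono-≤ (ceiling-least (T s d ε) {Z * (q * q)} T≤) ⟩
      ⌈log₂ (Z * (q * q)) ⌉
        ≤⟨ ⌈log₂*⌉ Z (q * q) ⟩
      ⌈log₂ Z ⌉ + ⌈log₂ (q * q) ⌉
        ≤⟨ +-mono-≤ logZ≤ (⌈log₂*⌉ q q) ⟩
      9 + (d + d) + L + (Lε + Lε)
        ≤⟨ +-mono-≤ (+-mono-≤ (+-mono-≤ (*-monoʳ-≤ 9 (≤-trans 1≤d d≤)) (+-mono-≤ d≤ d≤)) L≤) (+-mono-≤ Lε≤ Lε≤) ⟩
      9 * (L * Lε) + (L * Lε + L * Lε) + L * Lε + (L * Lε + L * Lε)
        ≡⟨ collect (L * Lε) ⟩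
      14 * (L * Lε) ∎
      where
      open ≤-Reasoning
      collect : ∀ x → 9 * x + (x + x) + x + (x + x) ≡ 14 * x
      collect = solve-∀
      d≤L : d ≤ L
      d≤L = 2^k≤n⇒k≤⌈log₂n⌉ d (≤-trans 2^d≤N N≤ceiling)
      L≤ : L ≤ L * Lε
      L≤ = ≤-trans (≤-reflexive (sym (*-identityʳ L))) (*-monoʳ-≤ L (2^k≤n⇒k≤⌈log₂n⌉ 1 1<q))
      Lε≤ : Lε ≤ L * Lε
      Lε≤ = ≤-trans (≤-reflexive (sym (*-identityˡ Lε))) (*-monoˡ-≤ Lε (≤-trans 1≤d d≤L))
      d≤ : d ≤ L * Lε
      d≤ = ≤-trans d≤L L≤
      T≤ : T s d ε ℚ.≤ fromℕ (Z * (q * q))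
      T≤ = ℚ.≤-trans (ℚ-*-mono-≤ (0≤fromℕ Z) (subst (0ℚ ℚ.≤_) (fromℕ-* q q) (0≤fromℕ (q * q))) ℚ.≤-refl
                       (ℚ-*-mono-≤ 0≤y (0≤fromℕ q) y≤q y≤q))
             (ℚ.≤-reflexive (sym (trans (fromℕ-* Z (q * q)) (cong (fromℕ Z ℚ.*_) (fromℕ-* q q)))))
      log-d≤d : ⌈log₂ d ⌉ ≤ d
      log-d≤d = n≤2^k⇒⌈log₂n⌉≤k d (n≤2^n d)
      logZ≤ : ⌈log₂ Z ⌉ ≤ 9 + (d + d) + L
      logZ≤ = begin
        ⌈log₂ Z ⌉                                                ≡⟨ cong ⌈log₂_⌉ Z≡ ⟩
        ⌈log₂ (324 * (d * d) * N) ⌉                              ≤⟨ ⌈log₂*⌉ (324 * (d * d)) N ⟩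
        ⌈log₂ (324 * (d * d)) ⌉ + ⌈log₂ N ⌉                      ≤⟨ +-mono-≤ (⌈log₂*⌉ 324 (d * d)) (⌈log₂⌉-mono-≤ N≤ceiling) ⟩
        ⌈log₂ 324 ⌉ + ⌈log₂ (d * d) ⌉ + L                        ≤⟨ +-monoˡ-≤ L (+-mono-≤ (n≤2^k⇒⌈log₂n⌉≤k {324} 9 (m≤m+n 324 188))
                                                                     (≤-trans (⌈log₂*⌉ d d) (+-mono-≤ log-d≤d log-d≤d))) ⟩
        9 + (d + d) + L                                          ∎

    -- The factor `d ^ 2` in `T` and `log T` itself account for the three powers of `L * Lε`, and
    -- 4536 = 324 * 14.
    TlogT≤polylog : TlogT s d ε ℚ.≤ fromℕ 4536 ℚ.* polylogBound 3 s d ε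
    TlogT≤polylog = begin
      fromℕ Z ℚ.* (y ℚ.* y) ℚ.* fromℕ l
        ≡⟨ shuffle₁ (fromℕ Z) (y ℚ.* y) (fromℕ l) ⟩
      fromℕ Z ℚ.* fromℕ l ℚ.* (y ℚ.* y)
        ≡⟨ cong (ℚ._* (y ℚ.* y)) (fromℕ-* Z l) ⟨
      fromℕ (Z * l) ℚ.* (y ℚ.* y)
        ≤⟨ ℚ-*-mono-≤ (0≤fromℕ (Z * l)) 0≤y² (fromℕ-mono {Z * l} {4536 * (N * Λ ^ 3)} count) ℚ.≤-refl ⟩
      fromℕ (4536 * (N * Λ ^ 3)) ℚ.* (y ℚ.* y)
        ≡⟨ cong (ℚ._* (y ℚ.* y)) (trans (fromℕ-* 4536 (N * Λ ^ 3)) (cong (fromℕ 4536 ℚ.*_) (fromℕ-* N (Λ ^ 3)))) ⟩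
      fromℕ 4536 ℚ.* (fromℕ N ℚ.* fromℕ (Λ ^ 3)) ℚ.* (y ℚ.* y)
        ≡⟨ shuffle₂ (fromℕ 4536) (fromℕ N) (fromℕ (Λ ^ 3)) (y ℚ.* y) ⟩
      fromℕ 4536 ℚ.* (fromℕ N ℚ.* (y ℚ.* y) ℚ.* fromℕ (Λ ^ 3)) ∎
      where
      open ℚ.≤-Reasoning
      open ℚ.+-*-Solver
      l Λ : ℕ
      l = log (T s d ε)
      Λ = L * Lε
      0≤y² : 0ℚ ℚ.≤ y ℚ.* y
      0≤y² = ℚ.≤-trans (ℚ.≤-reflexive (sym (ℚ.*-zeroˡ y))) (ℚ.*-monoʳ-≤-nonNeg y {{ℚ.nonNegative 0≤y}} 0≤y)
      shuffle₁ : ∀ a b c → a ℚ.* b ℚ.* c ≡ a ℚ.* c ℚ.* b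
      shuffle₁ = solve 3 (λ a b c → a :* b :* c := a :* c :* b) refl
      shuffle₂ : ∀ k a b c → k ℚ.* (a ℚ.* b) ℚ.* c ≡ k ℚ.* (a ℚ.* c ℚ.* b)
      shuffle₂ = solve 4 (λ k a b c → k :* (a :* b) :* c := k :* (a :* c :* b)) refl
      d≤Λ : d ≤ Λ
      d≤Λ = ≤-trans (2^k≤n⇒k≤⌈log₂n⌉ d (≤-trans 2^d≤N N≤ceiling))
        (≤-trans (≤-reflexive (sym (*-identityʳ L))) (*-monoʳ-≤ L (2^k≤n⇒k≤⌈log₂n⌉ 1 1<q)))
      count : Z * l ≤ 4536 * (N * Λ ^ 3)
      count = ≤-trans (*-mono-≤ (≤-trans (≤-reflexive Z≡) (*-monoˡ-≤ N (*-monoʳ-≤ 324 (*-mono-≤ d≤Λ d≤Λ)))) logT≤)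
        (≤-reflexive (cube Λ N))
        where
        cube : ∀ x N → 324 * (x * x) * N * (14 * x) ≡ 4536 * (N * (x * (x * (x * 1))))
        cube = solve-∀

-- The testers

record RankProperty (s d : ℕ) (P : ∀ {n m} → Property n m) : Set where
  field
    P?      : ∀ {n m} (M : Matrix n m) → Dec (P M)
    ≐-resp  : ∀ {n m} {M M′ : Matrix n m} → M ≐ M′ → P M → P M′
    P⇒cover : ∀ {n m} (M : Matrix n m) → P M → HasCover s M d
    -- Lets distance from the property pass to distance from all covered matrices. The premise
    -- excludes sizes at which no matrix has the property, as for rank exactly `d` when `n` or `m`
    -- is below `d`.
    nearby  : ∀ {n m} → ∃ (P {n} {m}) → ∀ M → HasCover s M d → ∃ λ M′ → P {n} {m} M′ × distance M M′ ≤ d * d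

module Tester (s d : ℕ) (1≤d : 1 ≤ d) (P : ∀ {n m} → Property n m) (isRankProperty : RankProperty s d P) where

  open RankProperty isRankProperty

  module _ (ε : ℚ) .{{_ : Positive ε}} (n m : ℕ) where

    open Consistency {n} {m} P P? ≐-resp

    private
      q : ℕ
      q = ceilingℕ (inverse ε)

    open Sampling s d q {n} {m}

    allEntries : List (Fin n × Fin m)
    allEntries = cartesianProduct (allFin n) (allFin m)

    fullTester : NonAdaptiveTester n m
    fullTester = tester (tt ∷ []) (λ _ → allEntries)

    -- Beyond this threshold `q * (d * d)` is less than half of `n * m`, so the `d * d` changes of
    -- `nearby` cost at most half of the distance; below it, reading every entry is cheap enough.
    Small : Set
    Small = n * m ≤ 2 * (d * d) * q

    module Large (large : ¬ Small) where

      1≤nm : 1 ≤ n * m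
      1≤nm = ≤-trans (s≤s z≤n) (≰⇒> large)

      instance
        nonZeros : NonZero (n * m)
        nonZeros = >-nonZero 1≤nm

        n-nonZero : NonZero n
        n-nonZero = m*n≢0⇒m≢0 n

        m-nonZero : NonZero m
        m-nonZero = m*n≢0⇒n≢0 n

      samples-nonZero : NonZero (length (samplesList {n} {m}))
      samples-nonZero = subst NonZero (sym length-samplesList)
        (m*n≢0 (n ^ α (suc d)) (m ^ β 0) {{m^n≢0 n (α (suc d))}} {{m^n≢0 m (β 0)}})

      samplingTester : NonAdaptiveTester n m
      samplingTester = tester (samplesList {n} {m}) {{samples-nonZero}} gridQueries

    choose : Dec Small → NonAdaptiveTester n m
    choose (yes _)    = fullTester
    choose (no large) = Large.samplingTester large

    rankTester : NonAdaptiveTester n m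
    rankTester = choose (n * m ≤? 2 * (d * d) * q)

    module _ (ε<1 : ε ℚ.< 1ℚ) where

      open Accuracy ε ε<1 using (far⇒; 1<q; ≤TlogT; Z≡)
      open Accuracy ε ε<1 using () renaming (Z to Z′; N to N′)

      Correct : NonAdaptiveTester n m → Set
      Correct τ = IsTester ε P τ × OneSided P τ × MakesAtMost τ (fromℕ 88 ℚ.* TlogT s d ε)

      -- One-sidedness is built into the consistency verdict. What is left is that at most a third
      -- of the samples accept a far matrix, and the count of queries.
      correct : ∀ {S : Set} (σs : List S) {{_ : NonZero (length σs)}} (qs : S → List (Fin n × Fin m)) →
                (∀ M → Far ε P M → 3 * ∑ σs (λ σ → #[ accepts? σs qs M σ ]) ≤ length σs) →
                (∀ σ → length (qs σ) ≤ 22 * (Z′ s d 1≤d * d) * (q * q)) →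
                Correct (tester σs qs)
      correct σs qs few short =
        record { complete = λ M p → ℚ.≤-trans (fromℚᵘ-mono-≤ {mkℚᵘ (ℤ.+ 2) 2} {mkℚᵘ (ℤ.+ 1) 0} (ℚᵘ.*≤* (ℤ.+≤+ (s≤s (s≤s z≤n)))))
                                              (ℚ.≤-reflexive (sym (oneSided M p)))
               ; sound    = sound }
        , oneSided
        , λ ρ → ≤TlogT s d 1≤d {length (qs (List.lookup σs ρ))} (short (List.lookup σs ρ))
        where
        τ = tester σs qs
        oneSided : OneSided P τ
        oneSided M p = trans (cong (λ k → ℤ.+ k ℚ./ length σs) (accepting-all σs qs M p)) (n/n≡1 (length σs))
        sound : ∀ M → Far ε P M → ℤ.+ 2 ℚ./ 3 ℚ.≤ rejectProbability τ M
        sound M far = 2/3≤ ∣ ∁ (accepting τ M) ∣ (length σs) (begin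
          2 * length σs                                  ≡⟨ m+n∸m≡n (length σs) (2 * length σs) ⟨
          3 * length σs ∸ length σs                      ≤⟨ ∸-monoʳ-≤ (3 * length σs)
                                                              (≤-trans (≤-reflexive (cong (3 *_) (accepting-count σs qs M))) (few M far)) ⟩
          3 * length σs ∸ 3 * ∣ accepting τ M ∣          ≡⟨ *-distribˡ-∸ 3 (length σs) ∣ accepting τ M ∣ ⟨
          3 * (length σs ∸ ∣ accepting τ M ∣)            ≡⟨ cong (3 *_) (∣∁p∣≡n∸∣p∣ (accepting τ M)) ⟨
          3 * ∣ ∁ (accepting τ M) ∣                      ∎)
          where open ≤-Reasoning

      private
        Nd Zd : ℕ
        Nd = N′ s d 1≤d
        Zd = Z′ s d 1≤d

        1≤q : 1 ≤ q
        1≤q = <⇒≤ 1<q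

      never : ∀ {S : Set} (σs : List S) (R : S → Set) (R? : ∀ σ → Dec (R σ)) → (∀ σ → ¬ R σ) →
              3 * ∑ σs (λ σ → #[ R? σ ]) ≤ length σs
      never σs R R? ¬R = ≤-trans (≤-reflexive (cong (3 *_) (trans
        (∑-cong σs λ σ → cong bit (dec-false (R? σ) (¬R σ))) (∑-zero σs)))) z≤n

      -- 22 * 324 = 6912 + 216.
      budget : ∀ {x} → x ≤ 6912 * (d * d * d * (q * q * Nd)) → x ≤ 22 * (Zd * d) * (q * q)
      budget x≤ = ≤-trans x≤ (≤-trans (m≤m+n _ (216 * (d * d * d * (q * q * Nd)))) (≤-reflexive
        (trans (expand d q Nd) (cong (λ z → 22 * (z * d) * (q * q)) (sym (Z≡ s d 1≤d))))))
        where
        expand : ∀ d q N → 6912 * (d * d * d * (q * q * N)) + 216 * (d * d * d * (q * q * N)) ≡ 22 * (324 * (d * d) * N * d) * (q * q)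
        expand = solve-∀

      full-correct : Small → Correct fullTester
      full-correct small = correct (tt ∷ []) (λ _ → allEntries) few short
        where
        few : ∀ M → Far ε P M → 3 * ∑ (tt ∷ []) (λ σ → #[ accepts? (tt ∷ []) (λ _ → allEntries) M σ ]) ≤ 1
        -- A matrix that agrees with `M` on all entries passes the property on to `M`, which would
        -- then be far from itself.
        few M far = never (tt ∷ []) (λ _ → Consistent allEntries (List.map (read M) allEntries)) (accepts? (tt ∷ []) (λ _ → allEntries) M) λ { _ (M′ , p , eq) →
          n≮0 (subst (n * m <_) (*-zeroʳ q) (far⇒ {n * m} {0} (subst (λ δ → ε ℚ.* fromℕ (n * m) ℚ.< fromℕ δ) (distance-≐ {M = M} {M} λ i j → refl)
            (far M (≐-resp {M = M′} {M} (λ i j → map-agree eq (∈-cartesianProduct⁺ (∈-allFin i) (∈-allFin j))) p))))) }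
        short : ∀ σ → length allEntries ≤ 22 * (Zd * d) * (q * q)
        short _ = budget (begin
          length allEntries                     ≡⟨ length-product _,_ (allFin n) (allFin m) ⟩
          length (allFin n) * length (allFin m) ≡⟨ cong₂ _*_ (length-allFin n) (length-allFin m) ⟩
          n * m                                 ≤⟨ small ⟩
          2 * (d * d) * q                       ≡⟨ pad d q ⟩
          2 * (d * d * 1 * (1 * q * 1))         ≤⟨ *-mono-≤ {2} {6912} (s≤s (s≤s z≤n)) (*-mono-≤ (*-monoʳ-≤ (d * d) 1≤d)
                                                     (*-mono-≤ (*-monoˡ-≤ q 1≤q) (*-mono-≤ (1≤C≤ d s) (m^n>0 2 d)))) ⟩
          6912 * (d * d * d * (q * q * Nd))     ∎)
          where
          open ≤-Reasoning
          pad : ∀ d q → 2 * (d * d) * q ≡ 2 * (d * d * 1 * (1 * q * 1))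
          pad = solve-∀

      module _ (large : ¬ Small) where

        open Large large

        -- The triangle inequality through a matrix with the property within `d * d` of `M′`.
        -- Doubling it and subtracting the bound from `large` removes the term `d * d`, at the price
        -- of `2 * q` for `q`.
        far-from-covers : ∀ M → ∃ (P {n} {m}) → Far ε P M → ∀ M′ → HasCover s M′ d → n * m ≤ 2 * q * distance M M′
        far-from-covers M ∃P far M′ c with nearby ∃P M′ c
        ... | M″ , p , near = +-cancelʳ-≤ (n * m) (n * m) (2 * q * δ) (begin
          n * m + n * m                    ≤⟨ +-mono-≤ nm≤ nm≤ ⟩
          q * (δ + d * d) + q * (δ + d * d) ≡⟨ expand q δ (d * d) ⟩
          2 * q * δ + 2 * (d * d) * q      ≤⟨ +-monoʳ-≤ (2 * q * δ) (<⇒≤ (≰⇒> large)) ⟩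
          2 * q * δ + n * m                ∎)
          where
          open ≤-Reasoning
          δ = distance M M′
          nm≤ : n * m ≤ q * (δ + d * d)
          nm≤ = ≤-trans (<⇒≤ (far⇒ {n * m} {distance M M″} (far M″ p)))
            (*-monoʳ-≤ q (≤-trans (distance-triangle M M′ M″) (+-monoʳ-≤ δ near)))
          expand : ∀ q δ e → q * (δ + e) + q * (δ + e) ≡ 2 * q * δ + 2 * e * q
          expand = solve-∀

        1≤D : 1 ≤ D
        1≤D = *-mono-≤ {1} {12} (s≤s z≤n) (*-mono-≤ {1} {suc d} (s≤s z≤n) 1≤q)

        sampling-correct : Correct samplingTester
        sampling-correct = correct samplesList {{samples-nonZero}} gridQueries few short
          where
          accept? : ∀ M σ → Dec (Consistent (gridQueries σ) (List.map (read M) (gridQueries σ)))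
          accept? = accepts? (samplesList {n} {m}) {{samples-nonZero}} gridQueries
          few? : ∀ M → Far ε P M → Dec (∃ (P {n} {m})) → 3 * ∑ samplesList (λ σ → #[ accept? M σ ]) ≤ length (samplesList {n} {m})
          -- If no matrix of this size has the property, no answers are consistent.
          few? M far (no ∄P)  = never (samplesList {n} {m}) (λ σ → Consistent (gridQueries σ) (List.map (read M) (gridQueries σ))) (accept? M) λ σ (M′ , p , _) → ∄P (M′ , p)
          -- `D` is three times the cancelled factor, and that factor is the union bound
          -- `suc d * (2 * Q)` for `Q = 2 * q`.
          few? M far (yes ∃P) = *-cancelˡ-≤ (4 * (suc d * q)) {{positive}} (begin
            4 * (suc d * q) * (3 * ∑ samplesList (λ σ → #[ accept? M σ ]))
              ≡⟨ regroup (suc d * q) (∑ samplesList (λ σ → #[ accept? M σ ])) ⟩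
            D * ∑ samplesList (λ σ → #[ accept? M σ ])
              ≤⟨ *-monoʳ-≤ D (∑-mono samplesList λ σ → #≤ (accept? M σ) λ (M′ , p , eq) → counted σ M′ p eq) ⟩
            D * ∑ samplesList (eventCount M)
              ≤⟨ eventCount-rare {n} {m} {2 * q} M (far-from-covers M ∃P far) ⟩
            suc d * (2 * (2 * q) * length samplesList)
              ≡⟨ regroup′ (suc d) q (length samplesList) ⟩
            4 * (suc d * q) * length samplesList ∎)
            where
            open ≤-Reasoning
            positive : NonZero (4 * (suc d * q))
            positive = >-nonZero (*-mono-≤ {1} {4} (s≤s z≤n) (*-mono-≤ {1} {suc d} (s≤s z≤n) 1≤q))
            regroup : ∀ e x → 4 * e * (3 * x) ≡ 12 * e * x
            regroup = solve-∀
            regroup′ : ∀ e q x → e * (2 * (2 * q) * x) ≡ 4 * (e * q) * x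
            regroup′ = solve-∀
            counted : ∀ σ M′ → P M′ → List.map (read M′) (gridQueries σ) ≡ List.map (read M) (gridQueries σ) → 1 ≤ eventCount M σ
            counted σ M′ p eq = count (passes⇒event M (proj₁ σ) (proj₂ σ) 1≤D
              (agree⇒passes M M′ σ (λ {i} {j} → map-agree {f = read M′} {g = read M} eq) (P⇒cover M′ p)))
              where
              count : (∃ λ i → Σ[ i<e ∈ i < suc d ] EventAt M (proj₁ σ) (proj₂ σ) i i<e) → 1 ≤ eventCount M σ
              count (i , i<e , event) = event⇒1≤eventCount M σ i i<e event
          few : ∀ M → Far ε P M → 3 * ∑ samplesList (λ σ → #[ accept? M σ ]) ≤ length (samplesList {n} {m})
          few M far = few? M far property?
          short : ∀ σ → length (gridQueries σ) ≤ 22 * (Zd * d) * (q * q)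
          short σ = budget (begin
            length (gridQueries σ)
              ≤⟨ gridQueries-length σ ⟩
            suc d * (6 * (D * D) * Nd)
              -- 864 = 6 * 12 * 12, with the two factors 12 from `D`; then `suc d ≤ d + d`, used
              -- three times, gives 6912 = 864 * 8.
              ≡⟨ expand (suc d) q Nd ⟩
            864 * (suc d * suc d * suc d * (q * q * Nd))
              ≤⟨ *-monoʳ-≤ 864 (*-monoˡ-≤ (q * q * Nd) (*-mono-≤ (*-mono-≤ d<2d d<2d) d<2d)) ⟩
            864 * ((d + d) * (d + d) * (d + d) * (q * q * Nd))
              ≡⟨ collect d (q * q * Nd) ⟩
            6912 * (d * d * d * (q * q * Nd)) ∎)
            where
            open ≤-Reasoning
            d<2d : suc d ≤ d + d
            d<2d = +-monoˡ-≤ d 1≤d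
            expand : ∀ e q N → e * (6 * (12 * (e * q) * (12 * (e * q))) * N) ≡ 864 * (e * e * e * (q * q * N))
            expand = solve-∀
            collect : ∀ d x → 864 * ((d + d) * (d + d) * (d + d) * x) ≡ 6912 * (d * d * d * x)
            collect = solve-∀

      rankTester-correct : Correct rankTester
      rankTester-correct = by-size (n * m ≤? 2 * (d * d) * q)
        where
        by-size : ∀ b → Correct (choose b)
        by-size (yes small) = full-correct small
        by-size (no large)  = sampling-correct large

atMost : ∀ s d → RankProperty s d (BinaryRankAtMost s d)
atMost s d = record
  { P?      = atMost? s d
  ; ≐-resp  = λ {n} {m} {M} {M′} → atMost-resp s d {M = M} {M′}
  ; P⇒cover = λ M → atMost⇒cover {M = M}
  ; nearby  = λ _ M c → M , cover⇒atMost d c , ≤-trans (≤-reflexive (distance-≐ {M = M} {M} λ i j → refl)) z≤n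
  }

exactly : ∀ s d → 1 ≤ s → 1 ≤ d → RankProperty s d (BinaryRankExactly s d)
exactly s d 1≤s 1≤d = record
  { P?      = exactly? s d
  ; ≐-resp  = λ {n} {m} {M} {M′} → exactly-resp s d {M = M} {M′}
  ; P⇒cover = λ M → proj₁
  ; nearby  = λ (M₀ , exact) M c → exactly-nearby M 1≤s 1≤d
                (proj₁ (exactly⇒≤ {M = M₀} 1≤s exact)) (proj₂ (exactly⇒≤ {M = M₀} 1≤s exact)) c
  }

testable : ∀ (P : ℕ → ℕ → ∀ {n m} → Property n m) → (∀ s d → 1 ≤ s → 1 ≤ d → RankProperty s d (P s d)) →
           TestableWithTlogTQueries P
testable P rank = 88 , λ s d 1≤s 1≤d →
  rankTester s d 1≤d (P s d) (rank s d 1≤s 1≤d) ,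
  λ ε ε<1 n m → rankTester-correct s d 1≤d (P s d) (rank s d 1≤s 1≤d) ε n m ε<1
  where open Tester

theorem2 : TestableWithTlogTQueries BinaryRankAtMost
    × TestableWithTlogTQueries BinaryRankExactly
    × (∃[ c ] ∃[ k ] ∀ s d → 1 ≤ s → 1 ≤ d →
    ∀ (ε : ℚ) .{{_ : Positive ε}} → ε ℚ.< 1ℚ →
    TlogT s d ε ℚ.≤ fromℕ c ℚ.* polylogBound k s d ε)
theorem2 =
    testable BinaryRankAtMost (λ s d _ _ → atMost s d)
  , testable BinaryRankExactly exactly
  , 4536 , 3 , λ s d _ 1≤d ε ε<1 → Accuracy.TlogT≤polylog ε ε<1 s d 1≤d
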